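{- For integers $r\ge 1$, $t\ge 2$, $u\ge 0$, and $0\le z\le \frac{q^r-1}{2(q-1)}$ with $k=\frac{q^r-1}{q-1}+1-z+u>r$ we have $\mathrm{A}_q(v,2k;k)\le lq^k+1+z(q-1)$, where $l=\frac{q^{v-k}-q^r}{q^k-1}$ and $v=kt+r$.
   Context: $q>1$ is a prime power. $\mathrm{A}_q(v,2k;k)$ denotes the maximum size of a partial $k$-spread in $\mathbb{F}_q^v$, i.e. of a set of $k$-dimensional subspaces of $\mathbb{F}_q^v$ with pairwise trivial (zero) intersection. -}

module Defs where

open import Level using (Level; _⊔_)
open import Data.Nat using (ℕ)
open import Data.Fin using (Fin; zero; suc)
open import Data.Product using (Σ; _×_; _,_)
open import Relation.Nullary using (¬_)
open import Relation.Binary.PropositionalEquality using (_≡_)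
open import Algebra.Bundles using (CommutativeRing)

record FiniteField (c ℓ : Level) (q : ℕ) : Set (Level.suc (c ⊔ ℓ)) where
  field
    commRing : CommutativeRing c ℓ
  open CommutativeRing commRing public
  field
    0≉1     : ¬ (0# ≈ 1#)
    inverse : ∀ x → ¬ (x ≈ 0#) → Σ Carrier (λ y → (x * y) ≈ 1#)
    enum    : Fin q → Carrier
    enum-injective  : ∀ i j → enum i ≈ enum j → i ≡ j
    enum-surjective : ∀ x → Σ (Fin q) (λ i → enum i ≈ x)

module _ {c ℓ : Level} {q : ℕ} (F : FiniteField c ℓ q) where
  open FiniteField F using (Carrier; _≈_; _+_; _*_; 0#)

  Vector : ℕ → Set c
  Vector v = Fin v → Carrier

  zeroVec : ∀ {v} → Vector v
  zeroVec _ = 0#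

  _≈ᵥ_ : ∀ {v} → Vector v → Vector v → Set ℓ
  x ≈ᵥ y = ∀ p → x p ≈ y p

  sumF : ∀ {n} → (Fin n → Carrier) → Carrier
  sumF {ℕ.zero}  f = 0#
  sumF {ℕ.suc n} f = f zero + sumF (λ i → f (suc i))

  lincomb : ∀ {k v} → (Fin k → Vector v) → (Fin k → Carrier) → Vector v
  lincomb B a p = sumF (λ i → a i * B i p)

  -- a family of k vectors is linearly independent; then its span is a
  -- k-dimensional subspace of F_q^v (and every such subspace arises this way)
  LinIndep : ∀ {k v} → (Fin k → Vector v) → Set (c ⊔ ℓ)
  LinIndep B = ∀ a → lincomb B a ≈ᵥ zeroVec → ∀ i → a i ≈ 0#

  TrivialIntersection : ∀ {k v} → (Fin k → Vector v) → (Fin k → Vector v) → Set (c ⊔ ℓ)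
  TrivialIntersection B C =
    ∀ a b → lincomb B a ≈ᵥ lincomb C b → lincomb B a ≈ᵥ zeroVec

  -- a partial k-spread of size n in F_q^v, each element given by a basis
  IsPartialSpread : ∀ {n k v} → (Fin n → Fin k → Vector v) → Set (c ⊔ ℓ)
  IsPartialSpread {n} S =
    (∀ i → LinIndep (S i)) ×
    (∀ i j → ¬ (i ≡ j) → TrivialIntersection (S i) (S j))

{-# OPTIONS --safe #-}

-- Write p = q − 1 and y = 1 + z p, and suppose a partial spread of size n = l qᵏ + 1 + y exists.
-- For linear forms f₁, …, fⱼ let η be the number of nonzero vectors of their common kernel that lie
-- in no spread element, and put i = k − j.  Every intersection of this kernel with the ambient
-- space or with a spread element has a power of q divisible by qⁱ as its size, whence
--   η + qⁱ ≡ y  (mod p qⁱ),   say   η + qⁱ = C p qⁱ + y,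
-- with C = m − z for j = 0, where m = (qʳ − 1)/p.  Averaging over one further form yields a kernel
-- with at most η/q uncovered vectors; as y > 0 and by the congruence, C then drops by at least 1.
-- After m − 2z steps C ≤ z and i = z + 1 + u.  Now let N be the count after adding one more form.
-- By the congruence N lies in a residue class A mod B = p qⁱ⁻¹, so (N − A)(N − A + B) ≥ 0.
-- Summing this over all forms, the first two moments of N (uncovered vectors are pairwise
-- independent up to scalars) give qⁱ y ≤ y² + η, hence 2 qⁱ ≤ y² + y, which contradicts the
-- binomial expansion of qⁱ.
module Submission where

open import Defs
open import Level using (Level; 0ℓ)
open import Algebra.Bundles using (CommutativeRing; RawRing)
open import Algebra.Core using (Op₁; Op₂)
import Algebra.Morphism.RingMonomorphism as RingMonomorphism
open import Algebra.Morphism.Structures using (IsRingMonomorphism)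
import Algebra.Properties.Ring
open import Algebra.Structures using (IsCommutativeRing)
open import Data.Bool.Base using (if_then_else_)
open import Data.Fin using (Fin; zero; suc; inject≤)
open import Data.Fin.Properties as Fin using (*↔×; nonZeroIndex)
open import Data.List.Base using (List; []; _∷_; length)
open import Data.Nat using (ℕ; zero; suc; pred; _+_; _*_; _∸_; _^_; _≤_; _<_; z≤n; s≤s; s≤s⁻¹; NonZero; >-nonZero⁻¹)
open import Data.Nat.Properties
open import Data.Nat.Tactic.RingSolver using (solve-∀)
open import Data.Product using (∃; ∃₂; _×_; _,_; proj₁; proj₂; uncurry)
open import Data.Product.Function.NonDependent.Propositional using (_×-↔_)
open import Data.Sum using (_⊎_; inj₁; inj₂)
open import Data.Unit using (⊤; tt)
open import Data.Vec.Base using (Vec; []; _∷_; replicate; zipWith; tabulate; lookup)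
open import Data.Vec.Properties using (≡-dec; lookup-zipWith; lookup-replicate; lookup∘tabulate; tabulate∘lookup; tabulate-cong)
open import Function using (_∘_; id; _↔_; mk↔ₛ′; Inverse)
open import Function.Construct.Composition using (_↔-∘_)
open import Function.Construct.Identity using (↔-id)
open import Function.Construct.Symmetry using (↔-sym)
open import Relation.Binary.Definitions using (DecidableEquality)
open import Relation.Binary.PropositionalEquality
import Relation.Binary.Reasoning.Setoid
open import Relation.Nullary using (¬_; Dec; yes; no; does; contradiction)
open import Relation.Nullary.Decidable using (map′; _×-dec_; ¬?; decidable-stable)
open import Relation.Unary using (Decidable)

open import Algebra.Properties.Semiring.Sum +-*-semiring
  using (sum; sum-cong-≗; ∑-distrib-+; ∑-comm; *-distribˡ-sum; sum-permute)

-- Sums over finite types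

𝟙 : {P : Set} → Dec P → ℕ
𝟙 P? = if does P? then 1 else 0

𝟙-yes : {P : Set} (P? : Dec P) → P → 𝟙 P? ≡ 1
𝟙-yes (yes _) _ = refl
𝟙-yes (no ¬p) p = contradiction p ¬p

𝟙-no : {P : Set} (P? : Dec P) → ¬ P → 𝟙 P? ≡ 0
𝟙-no (yes p) ¬p = contradiction p ¬p
𝟙-no (no _)  _  = refl

𝟙-cong : {P Q : Set} (P? : Dec P) (Q? : Dec Q) → (P → Q) → (Q → P) → 𝟙 P? ≡ 𝟙 Q?
𝟙-cong (yes p) Q? to from = sym (𝟙-yes Q? (to p))
𝟙-cong (no ¬p) Q? to from = sym (𝟙-no Q? (¬p ∘ from))

𝟙-× : {P Q : Set} (P? : Dec P) (Q? : Dec Q) → 𝟙 (P? ×-dec Q?) ≡ 𝟙 P? * 𝟙 Q?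
𝟙-× (yes _) (yes _) = refl
𝟙-× (yes _) (no _)  = refl
𝟙-× (no _)  _       = refl

𝟙≤1 : {P : Set} (P? : Dec P) → 𝟙 P? ≤ 1
𝟙≤1 (yes _) = s≤s z≤n
𝟙≤1 (no _)  = z≤n

𝟙≢0 : {P : Set} (P? : Dec P) → 𝟙 P? ≢ 0 → P
𝟙≢0 (yes p) _  = p
𝟙≢0 (no _)  ≢0 = contradiction refl ≢0

sum-mono : ∀ {n} {f g : Fin n → ℕ} → (∀ i → f i ≤ g i) → sum f ≤ sum g
sum-mono {zero}  f≤g = z≤n
sum-mono {suc n} f≤g = +-mono-≤ (f≤g zero) (sum-mono (f≤g ∘ suc))

sum-const : ∀ n c → sum {n} (λ _ → c) ≡ n * c
sum-const zero    c = refl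
sum-const (suc n) c = cong (c +_) (sum-const n c)

sum≢0 : ∀ {n} (f : Fin n → ℕ) → sum f ≢ 0 → ∃ λ i → f i ≢ 0
sum≢0 {zero}  f ≢0 = contradiction refl ≢0
sum≢0 {suc n} f ≢0 with f zero ≟ 0
... | no f₀≢0  = zero , f₀≢0
... | yes f₀≡0 with sum≢0 (f ∘ suc) (≢0 ∘ cong₂ _+_ f₀≡0)
...   | i , fᵢ≢0 = suc i , fᵢ≢0

sum≤1 : ∀ {n} (f : Fin n → ℕ) → (∀ i → f i ≤ 1) →
        (∀ i j → f i ≢ 0 → f j ≢ 0 → i ≡ j) → sum f ≤ 1
sum≤1 {zero}  f f≤1 unique = z≤n
sum≤1 {suc n} f f≤1 unique with sum (f ∘ suc) ≟ 0
... | yes rest≡0 = subst (_≤ 1) (sym (trans (cong (f zero +_) rest≡0) (+-identityʳ _))) (f≤1 zero)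
... | no rest≢0 with sum≢0 (f ∘ suc) rest≢0
...   | i , fᵢ≢0 with f zero ≟ 0
...     | yes f₀≡0 = subst (_≤ 1) (sym (cong (_+ sum (f ∘ suc)) f₀≡0))
                       (sum≤1 (f ∘ suc) (f≤1 ∘ suc)
                         λ j k fⱼ fₖ → Fin.suc-injective (unique (suc j) (suc k) fⱼ fₖ))
...     | no f₀≢0 with () ← unique zero (suc i) f₀≢0 fᵢ≢0

sum-δ : ∀ {n} (i : Fin n) (f : Fin n → ℕ) → sum (λ j → 𝟙 (i Fin.≟ j) * f j) ≡ f i
sum-δ {suc n} zero f = trans (cong₂ _+_ (*-identityˡ (f zero)) (trans (sum-const n 0) (*-zeroʳ n)))
                         (+-identityʳ (f zero))
sum-δ {suc n} (suc i) f = trans (sum-cong-≗ λ j → cong (_* f (suc j))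
                            (𝟙-cong (suc i Fin.≟ suc j) (i Fin.≟ j) Fin.suc-injective (cong suc)))
                         (sum-δ i (f ∘ suc))

record Finite (A : Set) : Set where
  field
    size        : ℕ
    enumeration : Fin size ↔ A

  open Inverse enumeration public
    using () renaming (to to element; from to index; strictlyInverseˡ to element-index;
                       strictlyInverseʳ to index-element)

card : ∀ A → ⦃ Finite A ⦄ → ℕ
card A ⦃ fin ⦄ = Finite.size fin

instance
  finiteFin : ∀ {n} → Finite (Fin n)
  finiteFin {n} = record { size = n ; enumeration = ↔-id _ }

  finiteVec : {A : Set} → ⦃ Finite A ⦄ → ∀ {n} → Finite (Vec A n)
  finiteVec       {n = zero}   = record
    { size = 1 ; enumeration = mk↔ₛ′ (λ _ → []) (λ _ → zero) (λ { [] → refl }) (λ { zero → refl }) }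
  finiteVec ⦃ fin ⦄ {n = suc n} = record
    { size        = Finite.size fin * Finite.size (finiteVec ⦃ fin ⦄ {n})
    ; enumeration = mk↔ₛ′ (uncurry Vec._∷_) (λ { (x ∷ xs) → x , xs }) (λ { (_ ∷ _) → refl }) (λ _ → refl)
                      ↔-∘ ((Finite.enumeration fin ×-↔ Finite.enumeration finiteVec) ↔-∘ *↔×)
    }

card-Vec : {A : Set} ⦃ _ : Finite A ⦄ → ∀ n → card (Vec A n) ≡ card A ^ n
card-Vec zero    = refl
card-Vec {A} (suc n) = cong (card A *_) (card-Vec n)

module _ {A : Set} ⦃ fin : Finite A ⦄ where
  open Finite fin

  ∃? : {P : A → Set} → Decidable P → Dec (∃ P)
  ∃? {P} P? = map′ (λ (i , p) → element i , p)
    (λ (x , p) → index x , subst P (sym (element-index x)) p) (Fin.any? (P? ∘ element))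

  opaque
    ∑ : (A → ℕ) → ℕ
    ∑ f = sum (f ∘ element)

    ∑-cong : {f g : A → ℕ} → (∀ x → f x ≡ g x) → ∑ f ≡ ∑ g
    ∑-cong f≗g = sum-cong-≗ (f≗g ∘ element)

    ∑-mono : {f g : A → ℕ} → (∀ x → f x ≤ g x) → ∑ f ≤ ∑ g
    ∑-mono f≤g = sum-mono (f≤g ∘ element)

    ∑-+ : (f g : A → ℕ) → ∑ (λ x → f x + g x) ≡ ∑ f + ∑ g
    ∑-+ f g = ∑-distrib-+ (f ∘ element) (g ∘ element)

    ∑-*ˡ : ∀ c (f : A → ℕ) → ∑ (λ x → c * f x) ≡ c * ∑ f
    ∑-*ˡ c f = sym (*-distribˡ-sum c (f ∘ element))

    ∑-*ʳ : ∀ c (f : A → ℕ) → ∑ (λ x → f x * c) ≡ ∑ f * c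
    ∑-*ʳ c f = trans (∑-cong λ x → *-comm (f x) c) (trans (∑-*ˡ c f) (*-comm c (∑ f)))

    ∑-const : ∀ c → ∑ (λ _ → c) ≡ card A * c
    ∑-const = sum-const (card A)

    ∑≢0 : (f : A → ℕ) → ∑ f ≢ 0 → ∃ λ x → f x ≢ 0
    ∑≢0 f ≢0 with sum≢0 (f ∘ element) ≢0
    ... | i , fᵢ≢0 = element i , fᵢ≢0

    ∑≤1 : (f : A → ℕ) → (∀ x → f x ≤ 1) →
          (∀ x y → f x ≢ 0 → f y ≢ 0 → x ≡ y) → ∑ f ≤ 1
    ∑≤1 f f≤1 unique = sum≤1 (f ∘ element) (f≤1 ∘ element) λ i j fᵢ fⱼ →
      trans (sym (index-element i))
        (trans (cong index (unique (element i) (element j) fᵢ fⱼ)) (index-element j))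

    ∑-δ : (_≟ᴬ_ : DecidableEquality A) (x : A) (f : A → ℕ) → ∑ (λ y → 𝟙 (x ≟ᴬ y) * f y) ≡ f x
    ∑-δ _≟ᴬ_ x f = begin
      sum (λ j → 𝟙 (x ≟ᴬ element j) * f (element j))   ≡⟨ sum-cong-≗ (λ j → cong (_* f (element j)) (same j)) ⟩
      sum (λ j → 𝟙 (index x Fin.≟ j) * f (element j))  ≡⟨ sum-δ (index x) (f ∘ element) ⟩
      f (element (index x))                            ≡⟨ cong f (element-index x) ⟩
      f x                                              ∎
      where
      open ≡-Reasoning
      same : ∀ j → 𝟙 (x ≟ᴬ element j) ≡ 𝟙 (index x Fin.≟ j)
      same j = 𝟙-cong (x ≟ᴬ element j) (index x Fin.≟ j) (λ { refl → index-element j }) (λ { refl → sym (element-index x) })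

    ∑-𝟙≟ : (_≟ᴬ_ : DecidableEquality A) (x : A) → ∑ (λ y → 𝟙 (x ≟ᴬ y)) ≡ 1
    ∑-𝟙≟ _≟ᴬ_ x = trans (∑-cong λ y → sym (*-identityʳ (𝟙 (x ≟ᴬ y)))) (∑-δ _≟ᴬ_ x (λ _ → 1))

    ∑-reindex : (φ : A ↔ A) (f : A → ℕ) → ∑ f ≡ ∑ (f ∘ Inverse.to φ)
    ∑-reindex φ f = begin
      sum (f ∘ element)                             ≡⟨ sum-permute (f ∘ element) π ⟩
      sum (f ∘ element ∘ index ∘ to ∘ element)      ≡⟨ sum-cong-≗ {size} (λ i → cong f (element-index (to (element i)))) ⟩
      sum (f ∘ to ∘ element)                        ∎
      where
      open ≡-Reasoning
      open Inverse φ using (to)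
      π : Fin size ↔ Fin size
      π = ↔-sym enumeration ↔-∘ (φ ↔-∘ enumeration)

opaque
  unfolding ∑

  ∑-swap : {A B : Set} ⦃ finᴬ : Finite A ⦄ ⦃ finᴮ : Finite B ⦄ (f : A → B → ℕ) →
           ∑ (λ x → ∑ (f x)) ≡ ∑ (λ y → ∑ (λ x → f x y))
  ∑-swap ⦃ finᴬ ⦄ ⦃ finᴮ ⦄ f = ∑-comm λ i j → f (Finite.element finᴬ i) (Finite.element finᴮ j)

term≤∑ : ∀ {A : Set} ⦃ _ : Finite A ⦄ → (∀ (x y : A) → Dec (x ≡ y)) → (f : A → ℕ) (x : A) → f x ≤ ∑ f
term≤∑ _≟ᴬ_ f x = subst (_≤ ∑ f) (∑-δ _≟ᴬ_ x f)
  (∑-mono λ y → ≤-trans (*-monoˡ-≤ (f y) (𝟙≤1 (x ≟ᴬ y))) (≤-reflexive (*-identityˡ (f y))))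

-- Linear algebra over a field with carrier Fin q

-- With carrier `Fin q` and propositional equality, vectors form a finite type with decidable
-- equality, so subspaces can be counted by sums of indicators.
record FieldOnFin (q : ℕ) : Set where
  infixl 6 _⊕_
  infixl 7 _⊛_
  infix  8 ⊖_
  field
    _⊕_ _⊛_ : Op₂ (Fin q)
    ⊖_      : Op₁ (Fin q)
    𝟘 𝟙ᴷ    : Fin q
    isCommutativeRing : IsCommutativeRing _≡_ _⊕_ _⊛_ ⊖_ 𝟘 𝟙ᴷ
    invert  : ∀ x → x ≢ 𝟘 → ∃ λ y → x ⊛ y ≡ 𝟙ᴷ

module LinearAlgebra {q : ℕ} (K : FieldOnFin q) where
  open FieldOnFin K
  private
    ring : CommutativeRing _ _
    ring = record { isCommutativeRing = isCommutativeRing }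
    module R = CommutativeRing ring
    module RP = Algebra.Properties.Ring R.ring

  instance
    q≢0 : NonZero q
    q≢0 = nonZeroIndex 𝟘

  V : ℕ → Set
  V d = Vec (Fin q) d

  _≟ⱽ_ : ∀ {d} (x y : V d) → Dec (x ≡ y)
  _≟ⱽ_ = ≡-dec Fin._≟_

  infixl 6 _+[_]_
  -- The single operation x + b w stands for both addition and scaling: closure under it and
  -- compatibility with it express subspaces and linear maps in one condition each.
  _+[_]_ : ∀ {d} → V d → Fin q → V d → V d
  x +[ b ] w = zipWith (λ s t → s ⊕ b ⊛ t) x w

  𝟎 : ∀ {d} → V d
  𝟎 = replicate _ 𝟘

  scale : ∀ {d} → Fin q → V d → V d
  scale a x = 𝟎 +[ a ] x

  +[]-cancel : ∀ {d} {b c} → b ⊕ c ≡ 𝟘 → (x w : V d) → x +[ b ] w +[ c ] w ≡ x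
  +[]-cancel         b+c≡0 []      []      = refl
  +[]-cancel {b = b} {c} b+c≡0 (s ∷ x) (t ∷ w) = cong₂ _∷_ head≡ (+[]-cancel b+c≡0 x w)
    where
    open ≡-Reasoning
    head≡ : s ⊕ b ⊛ t ⊕ c ⊛ t ≡ s
    head≡ = begin
      s ⊕ b ⊛ t ⊕ c ⊛ t     ≡⟨ R.+-assoc s _ _ ⟩
      s ⊕ (b ⊛ t ⊕ c ⊛ t)   ≡⟨ cong (s ⊕_) (R.distribʳ t b c) ⟨
      s ⊕ (b ⊕ c) ⊛ t       ≡⟨ cong (λ e → s ⊕ e ⊛ t) b+c≡0 ⟩
      s ⊕ 𝟘 ⊛ t             ≡⟨ cong (s ⊕_) (R.zeroˡ t) ⟩
      s ⊕ 𝟘                 ≡⟨ R.+-identityʳ s ⟩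
      s                     ∎

  scale-𝟘 : ∀ {d} (x : V d) → scale 𝟘 x ≡ 𝟎
  scale-𝟘 []      = refl
  scale-𝟘 (s ∷ x) = cong₂ _∷_ (trans (R.+-identityˡ _) (R.zeroˡ s)) (scale-𝟘 x)

  infixl 8 _∙_
  _∙_ : ∀ {d} → V d → V d → Fin q
  []      ∙ []      = 𝟘
  (s ∷ f) ∙ (t ∷ x) = s ⊛ t ⊕ f ∙ x

  ∙-comm : ∀ {d} (f x : V d) → f ∙ x ≡ x ∙ f
  ∙-comm []      []      = refl
  ∙-comm (s ∷ f) (t ∷ x) = cong₂ _⊕_ (R.*-comm s t) (∙-comm f x)

  IsLinearForm : ∀ {d} → (V d → Fin q) → Set
  IsLinearForm g = ∀ x b w → g (x +[ b ] w) ≡ g x ⊕ b ⊛ g w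

  IsLinearMap : ∀ {d e} → (V d → V e) → Set
  IsLinearMap L = ∀ x b w → L (x +[ b ] w) ≡ L x +[ b ] L w

  ⊕-interchange : ∀ a b c d → (a ⊕ b) ⊕ (c ⊕ d) ≡ (a ⊕ c) ⊕ (b ⊕ d)
  ⊕-interchange a b c d = begin
    (a ⊕ b) ⊕ (c ⊕ d)  ≡⟨ R.+-assoc a b _ ⟩
    a ⊕ (b ⊕ (c ⊕ d))  ≡⟨ cong (a ⊕_) (R.+-assoc b c d) ⟨
    a ⊕ ((b ⊕ c) ⊕ d)  ≡⟨ cong (λ e → a ⊕ (e ⊕ d)) (R.+-comm b c) ⟩
    a ⊕ ((c ⊕ b) ⊕ d)  ≡⟨ cong (a ⊕_) (R.+-assoc c b d) ⟩
    a ⊕ (c ⊕ (b ⊕ d))  ≡⟨ R.+-assoc a c _ ⟨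
    (a ⊕ c) ⊕ (b ⊕ d)  ∎
    where open ≡-Reasoning

  ⊛-swap : ∀ a b c → a ⊛ (b ⊛ c) ≡ b ⊛ (a ⊛ c)
  ⊛-swap a b c = trans (sym (R.*-assoc a b c)) (trans (cong (_⊛ c) (R.*-comm a b)) (R.*-assoc b a c))

  ∙-linearʳ : ∀ {d} (f : V d) → IsLinearForm (f ∙_)
  ∙-linearʳ []      []      b []      = sym (trans (R.+-identityˡ _) (R.zeroʳ b))
  ∙-linearʳ (c ∷ f) (s ∷ x) b (t ∷ w) = begin
    c ⊛ (s ⊕ b ⊛ t) ⊕ f ∙ (x +[ b ] w)              ≡⟨ cong₂ _⊕_ (R.distribˡ c s _) (∙-linearʳ f x b w) ⟩
    (c ⊛ s ⊕ c ⊛ (b ⊛ t)) ⊕ (f ∙ x ⊕ b ⊛ (f ∙ w))   ≡⟨ ⊕-interchange _ _ _ _ ⟩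
    (c ⊛ s ⊕ f ∙ x) ⊕ (c ⊛ (b ⊛ t) ⊕ b ⊛ (f ∙ w))   ≡⟨ cong (λ e → (c ⊛ s ⊕ f ∙ x) ⊕ (e ⊕ b ⊛ (f ∙ w))) (⊛-swap c b t) ⟩
    (c ⊛ s ⊕ f ∙ x) ⊕ (b ⊛ (c ⊛ t) ⊕ b ⊛ (f ∙ w))   ≡⟨ cong (c ⊛ s ⊕ f ∙ x ⊕_) (R.distribˡ b _ _) ⟨
    (c ⊛ s ⊕ f ∙ x) ⊕ b ⊛ (c ⊛ t ⊕ f ∙ w)           ∎
    where open ≡-Reasoning

  ∙-linearˡ : ∀ {d} (x : V d) → IsLinearForm (_∙ x)
  ∙-linearˡ x f b g = trans (∙-comm (f +[ b ] g) x)
    (trans (∙-linearʳ x f b g) (cong₂ (λ s t → s ⊕ b ⊛ t) (∙-comm x f) (∙-comm x g)))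

  ∙-𝟎 : ∀ {d} (f : V d) → f ∙ 𝟎 ≡ 𝟘
  ∙-𝟎 []      = refl
  ∙-𝟎 (c ∷ f) = trans (cong₂ _⊕_ (R.zeroʳ c) (∙-𝟎 f)) (R.+-identityˡ 𝟘)

  ∙-scale : ∀ {d} (f : V d) a x → f ∙ scale a x ≡ a ⊛ (f ∙ x)
  ∙-scale f a x = trans (∙-linearʳ f 𝟎 a x)
    (trans (cong (_⊕ a ⊛ (f ∙ x)) (∙-𝟎 f)) (R.+-identityˡ _))

  -- The form `𝟙ᴷ ∷ 𝟎` reads off the first coordinate, and the forms `𝟘 ∷ f` reduce the rest to the
  -- tails.
  ∙-nondegenerate : ∀ {d} (x y : V d) → (∀ f → f ∙ x ≡ f ∙ y) → x ≡ y
  ∙-nondegenerate []      []      _  = refl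
  ∙-nondegenerate {suc d} (s ∷ x) (t ∷ y) eq = cong₂ _∷_
    (trans (sym (first s x)) (trans (eq (𝟙ᴷ ∷ 𝟎)) (first t y)))
    (∙-nondegenerate x y λ f → trans (sym (rest s x f)) (trans (eq (𝟘 ∷ f)) (rest t y f)))
    where
    first : ∀ c (z : V d) → (𝟙ᴷ ∷ 𝟎) ∙ (c ∷ z) ≡ c
    first c z = trans (cong₂ _⊕_ (R.*-identityˡ c) (trans (∙-comm 𝟎 z) (∙-𝟎 z))) (R.+-identityʳ c)
    rest : ∀ c (z : V d) f → (𝟘 ∷ f) ∙ (c ∷ z) ≡ f ∙ z
    rest c z f = trans (cong (_⊕ f ∙ z) (R.zeroˡ c)) (R.+-identityˡ _)

  # : ∀ {d} {P : V d → Set} → Decidable P → ℕ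
  # P? = ∑ (𝟙 ∘ P?)

  -- If g takes the value b ≠ 0 on P then translations inside P permute the fibres of g transitively.
  fibres : ∀ {d} {P : V d → Set} (P? : Decidable P) →
           (∀ x b w → P x → P w → P (x +[ b ] w)) →
           {g : V d → Fin q} → IsLinearForm g →
           (∀ x → P x → g x ≡ 𝟘) ⊎ # P? ≡ q * # (λ x → (g x Fin.≟ 𝟘) ×-dec P? x)
  fibres {d} {P} P? closed {g} linear with ∃? (λ w → P? w ×-dec ¬? (g w Fin.≟ 𝟘))
  ... | no none = inj₁ λ x px → decidable-stable (g x Fin.≟ 𝟘) λ gx≢0 → none (x , px , gx≢0)
  ... | yes (w , pw , gw≢0) with invert (g w) gw≢0
  ...   | c , gwc≡1 = inj₂ (begin
      -- Sort the vectors of P by the value `b` of `g`; all q fibres turn out to be as large as the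
      -- one over `𝟘`.
      ∑ (λ x → 𝟙 (P? x))
        ≡⟨ ∑-cong (λ x → ∑-δ Fin._≟_ (g x) (λ _ → 𝟙 (P? x))) ⟨
      ∑ (λ x → ∑ λ b → 𝟙 (g x Fin.≟ b) * 𝟙 (P? x))
        ≡⟨ ∑-swap (λ x b → 𝟙 (g x Fin.≟ b) * 𝟙 (P? x)) ⟩
      ∑ (λ b → ∑ λ x → 𝟙 (g x Fin.≟ b) * 𝟙 (P? x))
        ≡⟨ ∑-cong fibre ⟩
      ∑ {A = Fin q} (λ _ → # (λ x → (g x Fin.≟ 𝟘) ×-dec P? x))
        ≡⟨ ∑-const {A = Fin q} (# (λ x → (g x Fin.≟ 𝟘) ×-dec P? x)) ⟩
      q * # (λ x → (g x Fin.≟ 𝟘) ×-dec P? x) ∎)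
    where
    open ≡-Reasoning

    -- Since `c` is the inverse of `g w`, translation by (b c) w raises `g` by exactly `b`.
    τ : Fin q → V d → V d
    τ b x = x +[ b ⊛ c ] w

    step : ∀ b x → g (τ b x) ≡ g x ⊕ b
    step b x = trans (linear x (b ⊛ c) w) (cong (g x ⊕_) (begin
      b ⊛ c ⊛ g w    ≡⟨ R.*-assoc b c (g w) ⟩
      b ⊛ (c ⊛ g w)  ≡⟨ cong (b ⊛_) (trans (R.*-comm c (g w)) gwc≡1) ⟩
      b ⊛ 𝟙ᴷ         ≡⟨ R.*-identityʳ b ⟩
      b              ∎))

    translation : Fin q → V d ↔ V d
    translation b = mk↔ₛ′ (τ b) (_+[ ⊖ (b ⊛ c) ] w)
      (λ x → +[]-cancel (R.-‿inverseˡ (b ⊛ c)) x w)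
      (λ x → +[]-cancel (R.-‿inverseʳ (b ⊛ c)) x w)

    inside : ∀ b x → P (τ b x) → P x
    inside b x pτ = subst P (+[]-cancel (R.-‿inverseʳ (b ⊛ c)) x w) (closed _ _ _ pτ pw)

    to-zero : ∀ b x → g (τ b x) ≡ b → g x ≡ 𝟘
    to-zero b x eq = RP.+-cancelʳ b (g x) 𝟘
      (trans (sym (step b x)) (trans eq (sym (R.+-identityˡ b))))

    fibre : ∀ b → ∑ (λ x → 𝟙 (g x Fin.≟ b) * 𝟙 (P? x)) ≡ # (λ x → (g x Fin.≟ 𝟘) ×-dec P? x)
    fibre b = begin
      ∑ (λ x → 𝟙 (g x Fin.≟ b) * 𝟙 (P? x))
        ≡⟨ ∑-reindex (translation b) (λ x → 𝟙 (g x Fin.≟ b) * 𝟙 (P? x)) ⟩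
      ∑ (λ x → 𝟙 (g (τ b x) Fin.≟ b) * 𝟙 (P? (τ b x)))
        ≡⟨ ∑-cong (λ x → cong₂ _*_
             (𝟙-cong (g (τ b x) Fin.≟ b) (g x Fin.≟ 𝟘) (to-zero b x)
               λ gx≡0 → trans (step b x) (trans (cong (_⊕ b) gx≡0) (R.+-identityˡ b)))
             (𝟙-cong (P? (τ b x)) (P? x) (inside b x) λ px → closed _ _ _ px pw)) ⟩
      ∑ (λ x → 𝟙 (g x Fin.≟ 𝟘) * 𝟙 (P? x))
        ≡⟨ ∑-cong (λ x → 𝟙-× (g x Fin.≟ 𝟘) (P? x)) ⟨
      # (λ x → (g x Fin.≟ 𝟘) ×-dec P? x) ∎

  -- Common kernels of lists of linear forms

  Killed : ∀ {d} → List (V d) → V d → Set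
  Killed []       x = ⊤
  Killed (f ∷ fs) x = f ∙ x ≡ 𝟘 × Killed fs x

  killed? : ∀ {d} (fs : List (V d)) → Decidable (Killed fs)
  killed? []       x = yes tt
  killed? (f ∷ fs) x = (f ∙ x Fin.≟ 𝟘) ×-dec killed? fs x

  linear-closed : ∀ {s t} b → s ≡ 𝟘 → t ≡ 𝟘 → s ⊕ b ⊛ t ≡ 𝟘
  linear-closed b refl refl = trans (R.+-identityˡ _) (R.zeroʳ b)

  Killed-closed : ∀ {d} (fs : List (V d)) x b w → Killed fs x → Killed fs w → Killed fs (x +[ b ] w)
  Killed-closed []       x b w _          _          = tt
  Killed-closed (f ∷ fs) x b w (fx , fsx) (fw , fsw) =
    trans (∙-linearʳ f x b w) (linear-closed b fx fw) , Killed-closed fs x b w fsx fsw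

  Killed-𝟎 : ∀ {d} (fs : List (V d)) → Killed fs 𝟎
  Killed-𝟎 []       = tt
  Killed-𝟎 (f ∷ fs) = ∙-𝟎 f , Killed-𝟎 fs

  #-all : ∀ {d} → # {d} {λ _ → ⊤} (λ _ → yes tt) ≡ q ^ d
  #-all {d} = trans (∑-const {A = V d} 1) (trans (*-identityʳ (card (V d))) (card-Vec {A = Fin q} d))

  -- By `fibres`, each form of the list either divides the count by q or leaves it unchanged; `j`
  -- counts the forms of the second kind. With `L` the identity this treats the ambient space, with
  -- `L` an embedding a spread element.
  #-killed : ∀ {d e} {L : V d → V e} → IsLinearMap L → ∀ fs i → i + length fs ≡ d →
             ∃ λ j → # (killed? fs ∘ L) ≡ q ^ (i + j)
  #-killed linear [] i refl = 0 , #-all {i + 0}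
  #-killed {L = L} linear (f ∷ fs) i eq
    with #-killed linear fs (suc i) (trans (sym (+-suc i _)) eq)
       | fibres (killed? fs ∘ L)
           (λ x b w px pw → subst (Killed fs) (sym (linear x b w)) (Killed-closed fs _ b _ px pw))
           {λ x → f ∙ L x} (λ x b w → trans (cong (f ∙_) (linear x b w)) (∙-linearʳ f _ b _))
  ... | j , count | inj₁ f≡0 = suc j , trans
    (∑-cong λ x → 𝟙-cong (killed? (f ∷ fs) (L x)) (killed? fs (L x)) proj₂ (λ px → f≡0 x px , px))
    (trans count (cong (q ^_) (sym (+-suc i j))))
  ... | j , count | inj₂ split = j , *-cancelˡ-≡ _ _ q (trans (sym split) count)

  -- Evaluation at `x` is a linear form on the space of forms, and by nondegeneracy it is not
  -- identically zero, so `fibres` applies with the roles of vectors and forms exchanged.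
  #-orthogonal : ∀ {d} {x : V d} → x ≢ 𝟎 → q ^ d ≡ q * # (λ f → f ∙ x Fin.≟ 𝟘)
  #-orthogonal {d} {x} x≢0 with fibres (λ _ → yes tt) _ (∙-linearˡ x)
  ... | inj₁ x⊥ = contradiction
    (∙-nondegenerate x 𝟎 λ f → trans (x⊥ f tt) (sym (∙-𝟎 f))) x≢0
  ... | inj₂ split = trans (sym (#-all {d})) (trans split (cong (q *_)
    (∑-cong λ f → 𝟙-cong ((f ∙ x Fin.≟ 𝟘) ×-dec yes tt) (f ∙ x Fin.≟ 𝟘) proj₁ (_, tt))))

  -- Restrict evaluation at `y` to the forms that kill `x`. Either it is nonzero there and `fibres`
  -- gives the factor q, or every form killing `x` kills `y`, and then `y` is a multiple of `x`.
  #-orthogonal₂ : ∀ {d} {x y : V d} → x ≢ 𝟎 →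
    (∃ λ a → scale a x ≡ y) ⊎
    # (λ f → f ∙ x Fin.≟ 𝟘) ≡ q * # (λ f → (f ∙ y Fin.≟ 𝟘) ×-dec (f ∙ x Fin.≟ 𝟘))
  #-orthogonal₂ {d} {x} {y} x≢0
    with fibres (λ f → f ∙ x Fin.≟ 𝟘)
           (λ f b g fx gx → trans (∙-linearˡ x f b g) (linear-closed b fx gx)) (∙-linearˡ y)
       | ∃? (λ f → ¬? (f ∙ x Fin.≟ 𝟘))
  ... | inj₂ split | _ = inj₂ split
  ... | inj₁ y⊥ | no none = contradiction
    (∙-nondegenerate x 𝟎 λ f → trans (decidable-stable (f ∙ x Fin.≟ 𝟘) (λ fx → none (f , fx))) (sym (∙-𝟎 f))) x≢0
  ... | inj₁ y⊥ | yes (w , wx≢0) with invert (w ∙ x) wx≢0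
  ...   | c , wxc≡1 = inj₁ (a , ∙-nondegenerate (scale a x) y λ f → trans (∙-scale f a x) (proportional f))
    where
    open ≡-Reasoning
    -- The form `w` does not kill `x`. With b = (f ∙ x) c, the form f - b w kills `x`, hence `y`,
    -- which gives f ∙ y = (f ∙ x) c (w ∙ y).
    a : Fin q
    a = c ⊛ (w ∙ y)

    proportional : ∀ f → a ⊛ (f ∙ x) ≡ f ∙ y
    proportional f = sym (begin
      f ∙ y                    ≡⟨ RP.+-inverseˡ-unique _ _ (trans (sym (∙-linearˡ y f (⊖ b) w)) (y⊥ (f +[ ⊖ b ] w) f′x≡0)) ⟩
      ⊖ (⊖ b ⊛ (w ∙ y))        ≡⟨ cong ⊖_ (RP.-‿distribˡ-* b (w ∙ y)) ⟨
      ⊖ ⊖ (b ⊛ (w ∙ y))        ≡⟨ RP.-‿involutive _ ⟩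
      f ∙ x ⊛ c ⊛ (w ∙ y)      ≡⟨ R.*-assoc (f ∙ x) c (w ∙ y) ⟩
      f ∙ x ⊛ a                ≡⟨ R.*-comm (f ∙ x) a ⟩
      a ⊛ (f ∙ x)              ∎)
      where
      b : Fin q
      b = f ∙ x ⊛ c

      f′x≡0 : (f +[ ⊖ b ] w) ∙ x ≡ 𝟘
      f′x≡0 = begin
        (f +[ ⊖ b ] w) ∙ x           ≡⟨ ∙-linearˡ x f (⊖ b) w ⟩
        f ∙ x ⊕ ⊖ b ⊛ (w ∙ x)        ≡⟨ cong (f ∙ x ⊕_) (RP.-‿distribˡ-* b (w ∙ x)) ⟨
        f ∙ x ⊕ ⊖ (b ⊛ (w ∙ x))      ≡⟨ cong (λ e → f ∙ x ⊕ ⊖ e) (R.*-assoc (f ∙ x) c (w ∙ x)) ⟩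
        f ∙ x ⊕ ⊖ (f ∙ x ⊛ (c ⊛ (w ∙ x)))  ≡⟨ cong (λ e → f ∙ x ⊕ ⊖ (f ∙ x ⊛ e)) (trans (R.*-comm c (w ∙ x)) wxc≡1) ⟩
        f ∙ x ⊕ ⊖ (f ∙ x ⊛ 𝟙ᴷ)       ≡⟨ cong (λ e → f ∙ x ⊕ ⊖ e) (R.*-identityʳ (f ∙ x)) ⟩
        f ∙ x ⊕ ⊖ (f ∙ x)            ≡⟨ R.-‿inverseʳ (f ∙ x) ⟩
        𝟘                            ∎

  scale-𝟙 : ∀ {d} (x : V d) → scale 𝟙ᴷ x ≡ x
  scale-𝟙 []      = refl
  scale-𝟙 (s ∷ x) = cong₂ _∷_ (trans (R.+-identityˡ _) (R.*-identityˡ s)) (scale-𝟙 x)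

  infixl 6 _-ⱽ_
  _-ⱽ_ : ∀ {d} → V d → V d → V d
  x -ⱽ y = x +[ ⊖ 𝟙ᴷ ] y

  -ⱽ-self : ∀ {d} (x : V d) → x -ⱽ x ≡ 𝟎
  -ⱽ-self x = trans (cong (_-ⱽ x) (sym (scale-𝟙 x))) (+[]-cancel (R.-‿inverseʳ 𝟙ᴷ) 𝟎 x)

  -ⱽ≡𝟎⇒≡ : ∀ {d} (x y : V d) → x -ⱽ y ≡ 𝟎 → x ≡ y
  -ⱽ≡𝟎⇒≡ x y eq = begin
    x                     ≡⟨ +[]-cancel (R.-‿inverseˡ 𝟙ᴷ) x y ⟨
    x -ⱽ y +[ 𝟙ᴷ ] y      ≡⟨ cong (_+[ 𝟙ᴷ ] y) eq ⟩
    scale 𝟙ᴷ y            ≡⟨ scale-𝟙 y ⟩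
    y                     ∎
    where open ≡-Reasoning

  linear-𝟎 : ∀ {d e} {L : V d → V e} → IsLinearMap L → L 𝟎 ≡ 𝟎
  linear-𝟎 {L = L} linear = begin
    L 𝟎             ≡⟨ cong L (-ⱽ-self 𝟎) ⟨
    L (𝟎 -ⱽ 𝟎)      ≡⟨ linear 𝟎 (⊖ 𝟙ᴷ) 𝟎 ⟩
    L 𝟎 -ⱽ L 𝟎      ≡⟨ -ⱽ-self (L 𝟎) ⟩
    𝟎               ∎
    where open ≡-Reasoning

-- Arithmetic of the excess

-- The witness is the geometric sum 1 + q + ... + q^(j - 1) for q = 1 + p.
^-geometric : ∀ p j → ∃ λ g → suc p ^ j ≡ 1 + g * p
^-geometric p zero    = 0 , refl
^-geometric p (suc j) with ^-geometric p j
... | g , eq = g + p * g + 1 , trans (cong (suc p *_) eq) (expand p g)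
  where
  expand : ∀ p g → suc p * (1 + g * p) ≡ 1 + (g + p * g + 1) * p
  expand = solve-∀

-- Modulo p qⁱ all powers of q from qⁱ on are equal, so subspaces of unknown dimension at least i
-- still have a known size in the congruence.
^-split : ∀ p i j → ∃ λ g → suc p ^ (i + j) ≡ suc p ^ i + g * (p * suc p ^ i)
^-split p i j with ^-geometric p j
... | g , eq = g , trans (^-distribˡ-+-* (suc p) i j)
    (trans (cong (suc p ^ i *_) eq) (expand p g (suc p ^ i)))
  where
  expand : ∀ p g x → x * (1 + g * p) ≡ x + g * (p * x)
  expand = solve-∀

-- 2 (1 + p)^(z+1) is bounded below by the first three terms of its binomial expansion.
binomial-bound : ∀ p z → 2 + 2 * (1 + z) * p + z * (1 + z) * (p * p) ≤ 2 * suc p ^ (z + 1)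
binomial-bound p zero    = ≤-reflexive (base p)
  where
  base : ∀ p → 2 + 2 * (1 + 0) * p + 0 * (1 + 0) * (p * p) ≡ 2 * (suc p * 1)
  base = solve-∀
binomial-bound p (suc z) = begin
  2 + 2 * (2 + z) * p + (1 + z) * (2 + z) * (p * p)
    -- The added cubic term completes the expression to `suc p` times the bound for `z`.
    ≤⟨ m≤m+n _ (z * (1 + z) * (p * p * p)) ⟩
  2 + 2 * (2 + z) * p + (1 + z) * (2 + z) * (p * p) + z * (1 + z) * (p * p * p)
    ≡⟨ step p z ⟩
  suc p * (2 + 2 * (1 + z) * p + z * (1 + z) * (p * p))
    ≤⟨ *-monoʳ-≤ (suc p) (binomial-bound p z) ⟩
  suc p * (2 * suc p ^ (z + 1))
    ≡⟨ swap (suc p) (suc p ^ (z + 1)) ⟩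
  2 * suc p ^ (suc z + 1) ∎
  where
  open ≤-Reasoning
  step : ∀ p z → 2 + 2 * (2 + z) * p + (1 + z) * (2 + z) * (p * p) + z * (1 + z) * (p * p * p)
               ≡ suc p * (2 + 2 * (1 + z) * p + z * (1 + z) * (p * p))
  step = solve-∀
  swap : ∀ a b → a * (2 * b) ≡ 2 * (a * b)
  swap = solve-∀

-- The truncated binomial expansion exceeds y² + y by z p (p - 1) + 2 p, which is positive for p ≥
-- 1.
y²+y<2qⁱ : ∀ p .⦃ _ : NonZero p ⦄ z u → let y = 1 + z * p in y * y + y < 2 * suc p ^ (z + 1 + u)
-- After matching, `P` is q - 1 and `p` is q - 2, so that p - 1 needs no subtraction.
y²+y<2qⁱ (suc p) z u = begin-strict
  (1 + z * P) * (1 + z * P) + (1 + z * P)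
    <⟨ s≤s (m≤m+n _ (z * P * p + 2 * p + 1)) ⟩
  suc ((1 + z * P) * (1 + z * P) + (1 + z * P) + (z * P * p + 2 * p + 1))
    ≡⟨ expand p z ⟩
  2 + 2 * (1 + z) * P + z * (1 + z) * (P * P)
    ≤⟨ binomial-bound P z ⟩
  2 * suc P ^ (z + 1)
    ≤⟨ *-monoʳ-≤ 2 (^-monoʳ-≤ (suc P) (m≤m+n (z + 1) u)) ⟩
  2 * suc P ^ (z + 1 + u) ∎
  where
  open ≤-Reasoning
  P : ℕ
  P = suc p
  expand : ∀ p z → suc ((1 + z * suc p) * (1 + z * suc p) + (1 + z * suc p) + (z * suc p * p + 2 * p + 1))
                 ≡ 2 + 2 * (1 + z) * suc p + z * (1 + z) * (suc p * suc p)
  expand = solve-∀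

-- (N − A)(N − A + B) ≥ 0 when B divides N − A, with all subtracted terms moved to the left.
square-bound : ∀ {N A} B a b → N + a * B ≡ A + b * B →
               2 * A * N + A * B ≤ N * N + A * A + B * N
square-bound {N} {A} B a b eq with ≤-total a b
-- Here N = A + d B, and the two sides differ by d B (d B + B).
... | inj₁ a≤b = subst (λ N → 2 * A * N + A * B ≤ N * N + A * A + B * N) (sym N≡)
    (≤-trans (m≤m+n _ (d * B * (d * B + B))) (≤-reflexive (identity A B d)))
  where
  d : ℕ
  d = b ∸ a
  move : ∀ A B d a → A + (a + d) * B ≡ A + d * B + a * B
  move = solve-∀
  N≡ : N ≡ A + d * B
  N≡ = +-cancelʳ-≡ (a * B) N (A + d * B)
    (trans eq (trans (cong (λ b → A + b * B) (sym (m+[n∸m]≡n a≤b))) (move A B d a)))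
  identity : ∀ A B d → 2 * A * (A + d * B) + A * B + d * B * (d * B + B)
                     ≡ (A + d * B) * (A + d * B) + A * A + B * (A + d * B)
  identity = solve-∀
... | inj₂ b≤a = subst (λ A → 2 * A * N + A * B ≤ N * N + A * A + B * N) (sym A≡) (below (a ∸ b))
  where
  move : ∀ N B d b → N + (b + d) * B ≡ N + d * B + b * B
  move = solve-∀
  A≡ : A ≡ N + (a ∸ b) * B
  A≡ = +-cancelʳ-≡ (b * B) A (N + (a ∸ b) * B)
    (trans (sym eq) (trans (cong (λ a → N + a * B) (sym (m+[n∸m]≡n b≤a))) (move N B (a ∸ b) b)))
  identity₀ : ∀ N B → 2 * (N + 0 * B) * N + (N + 0 * B) * B ≡ N * N + (N + 0 * B) * (N + 0 * B) + B * N
  identity₀ = solve-∀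
  identity : ∀ N B d → 2 * (N + (1 + d) * B) * N + (N + (1 + d) * B) * B + (1 + d) * B * (d * B)
                     ≡ N * N + (N + (1 + d) * B) * (N + (1 + d) * B) + B * N
  identity = solve-∀
  -- Here A = N + d B, and the two sides differ by d B (d B - B); d = 0 is separate because d - 1
  -- must be a natural number.
  below : ∀ d → 2 * (N + d * B) * N + (N + d * B) * B ≤ N * N + (N + d * B) * (N + d * B) + B * N
  below zero    = ≤-reflexive (identity₀ N B)
  below (suc d) = ≤-trans (m≤m+n _ ((1 + d) * B * (d * B))) (≤-reflexive (identity N B d))

-- Reduce W + n = η + 1 + U modulo M = p X. The summand n on the left is l X + 1 + y since Q ≡ X mod
-- M. In U ≡ n X only n mod p matters, and Q ≡ y ≡ 1 mod p gives U ≡ (l + 2) X. What remains is η +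
-- X ≡ y.
congruence-arith : ∀ {η n p l z X Q W U} α β γ δ → let y = 1 + z * p ; M = p * X in
  n ≡ l * Q + 1 + y → Q ≡ X + γ * M → Q ≡ 1 + δ * p → W ≡ X + α * M → U ≡ n * X + β * M →
  W + n ≡ η + 1 + U →
  η + X + (l * δ + z + β) * M ≡ y + (α + l * γ) * M
congruence-arith {η} {n} {p} {l} {z} {X} {Q} {W} {U} α β γ δ n≡ Q≡ Q≡′ W≡ U≡ eq =
  +-cancelˡ-≡ ((l + 1) * X + 1) _ _ (begin
    (l + 1) * X + 1 + (η + X + (l * δ + z + β) * M)
      ≡⟨ right η p l z X β δ ⟩
    η + 1 + ((l * (1 + δ * p) + 1 + (1 + z * p)) * X + β * M)
      ≡⟨ cong (λ e → η + 1 + ((l * e + 1 + (1 + z * p)) * X + β * M)) Q≡′ ⟨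
    η + 1 + ((l * Q + 1 + (1 + z * p)) * X + β * M)
      ≡⟨ cong (λ e → η + 1 + (e * X + β * M)) n≡ ⟨
    η + 1 + (n * X + β * M)
      ≡⟨ cong (η + 1 +_) U≡ ⟨
    η + 1 + U
      ≡⟨ eq ⟨
    W + n
      ≡⟨ cong₂ _+_ W≡ (trans n≡ (cong (λ e → l * e + 1 + (1 + z * p)) Q≡)) ⟩
    X + α * M + (l * (X + γ * M) + 1 + (1 + z * p))
      ≡⟨ left p l z X α γ ⟩
    (l + 1) * X + 1 + (1 + z * p + (α + l * γ) * M) ∎)
  where
  open ≡-Reasoning
  M : ℕ
  M = p * X
  right : ∀ η p l z X β δ → (l + 1) * X + 1 + (η + X + (l * δ + z + β) * (p * X))
        ≡ η + 1 + ((l * (1 + δ * p) + 1 + (1 + z * p)) * X + β * (p * X))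
  right = solve-∀
  left : ∀ p l z X α γ → X + α * (p * X) + (l * (X + γ * (p * X)) + 1 + (1 + z * p))
       ≡ (l + 1) * X + 1 + (1 + z * p + (α + l * γ) * (p * X))
  left = solve-∀

-- Before any form is imposed all sizes are known exactly, so the congruence becomes an equation.
-- `V` and `R` stand for qᵛ and qʳ, and the hypothesis on `V` is the definition of l cleared of its
-- denominator.
base-arith : ∀ {η n p l z C Q R V} → let y = 1 + z * p in
  n ≡ l * Q + 1 + y → V + l * Q ≡ l * Q * Q + R * Q → R ≡ 1 + (z + C) * p →
  V + n ≡ η + 1 + n * Q →
  η + Q ≡ C * (p * Q) + y
base-arith {η} {n} {p} {l} {z} {C} {Q} {R} {V} refl V≡ refl eq =
  +-cancelˡ-≡ (l * Q * Q + Q + z * p * Q + 1) _ _ (begin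
    l * Q * Q + Q + z * p * Q + 1 + (η + Q)
      ≡⟨ right η p l z Q ⟩
    η + 1 + (l * Q + 1 + (1 + z * p)) * Q
      ≡⟨ eq ⟨
    V + (l * Q + 1 + (1 + z * p))
      ≡⟨ assoc V (l * Q) (1 + z * p) ⟩
    V + l * Q + (1 + (1 + z * p))
      ≡⟨ cong (_+ (1 + (1 + z * p))) V≡ ⟩
    l * Q * Q + (1 + (z + C) * p) * Q + (1 + (1 + z * p))
      ≡⟨ left p l z C Q ⟩
    l * Q * Q + Q + z * p * Q + 1 + (C * (p * Q) + (1 + z * p)) ∎)
  where
  open ≡-Reasoning
  right : ∀ η p l z Q → l * Q * Q + Q + z * p * Q + 1 + (η + Q) ≡ η + 1 + (l * Q + 1 + (1 + z * p)) * Q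
  right = solve-∀
  assoc : ∀ V a b → V + (a + 1 + b) ≡ V + a + (1 + b)
  assoc = solve-∀
  left : ∀ p l z C Q → l * Q * Q + (1 + (z + C) * p) * Q + (1 + (1 + z * p))
       ≡ l * Q * Q + Q + z * p * Q + 1 + (C * (p * Q) + (1 + z * p))
  left = solve-∀

-- Dividing the bound on η by q gives N + X ≤ (C + 1) M + y / q, which is strictly below (C + 1) M +
-- y as y > 0. Since N + X ≡ y mod M, the coefficient of M is then at most C.
descent-arith : ∀ {N η y C X} p .⦃ _ : NonZero p ⦄ .⦃ _ : NonZero y ⦄ α β →
  suc p * N ≤ η → η + suc p * X ≤ suc C * (p * (suc p * X)) + y →
  N + X + β * (p * X) ≡ y + α * (p * X) →
  N + X ≤ C * (p * X) + y
descent-arith {N} {η} {y} {C} {X} p α β average bound eq = +-cancelʳ-≤ (β * M) (N + X) (C * M + y) (begin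
    N + X + β * M         ≡⟨ eq ⟩
    y + α * M             ≤⟨ +-monoʳ-≤ y (*-monoˡ-≤ M (s≤s⁻¹ α<)) ⟩
    y + (C + β) * M       ≡⟨ move y C β M ⟩
    C * M + y + β * M     ∎)
  where
  open ≤-Reasoning
  M : ℕ
  M = p * X
  move : ∀ y C β M → y + (C + β) * M ≡ C * M + y + β * M
  move = solve-∀
  scaled : ∀ p C X y → suc C * (p * (suc p * X)) + suc p * y ≡ suc p * (suc C * (p * X) + y)
  scaled = solve-∀
  improved : N + X < suc C * M + y
  improved = *-cancelˡ-< (suc p) _ _ (begin-strict
    suc p * (N + X)                            ≡⟨ *-distribˡ-+ (suc p) N X ⟩
    suc p * N + suc p * X                      ≤⟨ +-monoˡ-≤ (suc p * X) average ⟩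
    η + suc p * X                              ≤⟨ bound ⟩
    suc C * (p * (suc p * X)) + y              <⟨ +-monoʳ-< (suc C * (p * (suc p * X))) (m<n+m y (≤-trans (>-nonZero⁻¹ p) (m≤m*n p y))) ⟩
    suc C * (p * (suc p * X)) + (p * y + y)    ≡⟨ cong (suc C * (p * (suc p * X)) +_) (+-comm (p * y) y) ⟩
    suc C * (p * (suc p * X)) + suc p * y      ≡⟨ scaled p C X y ⟩
    suc p * (suc C * M + y)                    ∎)
  α< : α < suc (C + β)
  α< = *-cancelʳ-< M α (suc (C + β)) (+-cancelˡ-< y _ _ (begin-strict
    y + α * M                 ≡⟨ eq ⟨
    N + X + β * M             <⟨ +-monoˡ-< (β * M) improved ⟩
    suc C * M + y + β * M     ≡⟨ move y (suc C) β M ⟨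
    y + suc (C + β) * M       ∎))

-- The mean η / q of the counts `N` lies between A - B and A when y < q s, so (N - A)(N - A + B) ≥ 0
-- is restrictive on average. After substituting `A`, `B` and `η` the averaged inequality collapses
-- to q s y ≤ y² + η, and the upper bound on η finishes.
contradiction-arith : ∀ p .⦃ _ : NonZero p ⦄ {z η e s} → let q = suc p ; y = 1 + z * p ; A = y + e * s ; B = p * s in
  η ≡ y + e * (q * s) →
  η + q * s ≤ z * (p * (q * s)) + y →
  2 * A * η * q + A * B * (q * q) ≤ η * (η + p * p) + A * A * (q * q) + B * η * q →
  2 * (q * s) ≤ y * y + y
contradiction-arith p {z} {_} {e} {s} refl bound moments =
  +-cancelʳ-≤ (z * (p * (q * s))) (2 * (q * s)) (y * y + y) (begin
    -- The term added to both sides completes one of the two copies of q s to q s y, because y = 1 +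
    -- z p.
    2 * (q * s) + z * (p * (q * s))     ≡⟨ left p z (q * s) ⟩
    q * s * y + q * s                   ≤⟨ +-monoˡ-≤ (q * s) variance ⟩
    y * y + η + q * s                   ≡⟨ +-assoc (y * y) η (q * s) ⟩
    y * y + (η + q * s)                 ≤⟨ +-monoʳ-≤ (y * y) bound ⟩
    y * y + (z * (p * (q * s)) + y)     ≡⟨ right (y * y) (z * (p * (q * s))) y ⟩
    y * y + y + z * (p * (q * s))       ∎)
  where
  open ≤-Reasoning
  q y A B η : ℕ
  q = suc p
  y = 1 + z * p
  A = y + e * s
  B = p * s
  η = y + e * (q * s)
  left : ∀ p z x → 2 * x + z * (p * x) ≡ x * (1 + z * p) + x
  left = solve-∀
  right : ∀ a b c → a + (b + c) ≡ a + c + b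
  right = solve-∀
  identity : ∀ p y e s → let q = suc p ; A = y + e * s ; B = p * s ; η = y + e * (q * s) in
    η * (η + p * p) + A * A * (q * q) + B * η * q + p * p * (q * s * y)
    ≡ 2 * A * η * q + A * B * (q * q) + p * p * (y * y + η)
  identity = solve-∀
  lhs rhs : ℕ
  lhs = 2 * A * η * q + A * B * (q * q)
  rhs = η * (η + p * p) + A * A * (q * q) + B * η * q
  -- By `identity`, the right side of `moments` minus the left side is p² (y² + η - q s y).
  variance : q * s * y ≤ y * y + η
  variance = *-cancelˡ-≤ (p * p) ⦃ m*n≢0 p p ⦄ (+-cancelˡ-≤ lhs _ _ (begin
    lhs + p * p * (q * s * y)   ≤⟨ +-monoˡ-≤ (p * p * (q * s * y)) moments ⟩
    rhs + p * p * (q * s * y)   ≡⟨ identity p y e s ⟩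
    lhs + p * p * (y * y + η)   ∎))

y<X : ∀ {y X} .⦃ _ : NonZero y ⦄ → y * y + y < 2 * X → y < X
y<X {y} {X} y²+y< = *-cancelˡ-< 2 y X (≤-<-trans (begin
  2 * y      ≡⟨ cong (y +_) (+-identityʳ y) ⟩
  y + y      ≤⟨ +-monoˡ-≤ y (m≤m*n y y) ⟩
  y * y + y  ∎) y²+y<)
  where open ≤-Reasoning

-- Since y < X ≤ η + X, the difference η + X - y is a positive multiple (c + 1) p X. Moving X over
-- leaves the coefficient e = (c + 1) p - 1, which makes η - y visibly divisible by X.
excess-form : ∀ p .⦃ _ : NonZero p ⦄ {η y X} α β → y < X →
  η + X + β * (p * X) ≡ y + α * (p * X) →
  ∃₂ λ c e → suc e ≡ suc c * p × η ≡ y + e * X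
excess-form p {η} {y} {X} α β y<X eq = c , e , e≡ ,
  +-cancelʳ-≡ (X + β * M) η (y + e * X) (begin
    η + (X + β * M)                          ≡⟨ +-assoc η X (β * M) ⟨
    η + X + β * M                            ≡⟨ eq ⟩
    y + α * M                                ≡⟨ cong (λ a → y + a * M) (m+[n∸m]≡n β<α) ⟨
    y + (suc β + c) * M                      ≡⟨ regroup y β c p X ⟩
    y + (suc c * p * X + β * M)              ≡⟨ cong (λ a → y + (a * X + β * M)) e≡ ⟨
    y + (suc e * X + β * M)                  ≡⟨ regroup′ y e X (β * M) ⟩
    y + e * X + (X + β * M)                  ∎)
  where
  open ≡-Reasoning
  M c e : ℕ
  M = p * X
  c = α ∸ suc β
  e = pred (suc c * p)
  e≡ : suc e ≡ suc c * p
  e≡ = suc-pred (suc c * p) ⦃ m*n≢0 (suc c) p ⦄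
  β<α : β < α
  β<α = ≰⇒> λ α≤β → <⇒≱ y<X (+-cancelʳ-≤ (β * M) X y
    (≤-trans (+-monoˡ-≤ (β * M) (m≤n+m X η))
      (≤-trans (≤-reflexive eq) (+-monoʳ-≤ y (*-monoˡ-≤ M α≤β)))))
  regroup : ∀ y β c p x → y + (suc β + c) * (p * x) ≡ y + (suc c * p * x + β * (p * x))
  regroup = solve-∀
  regroup′ : ∀ y e x b → y + (suc e * x + b) ≡ y + e * x + (x + b)
  regroup′ = solve-∀

-- The classes of y - s and y + e s modulo p s agree because e + 1 is a multiple of p. This puts all
-- counts after one more form into the class of A = y + e s.
congruence-shift : ∀ {N y p s c e} a b → suc e ≡ suc c * p →
  N + s + b * (p * s) ≡ y + a * (p * s) →
  N + (b + suc c) * (p * s) ≡ y + e * s + a * (p * s)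
congruence-shift {N} {y} {p} {s} {c} {e} a b e≡ eq = +-cancelʳ-≡ s _ _ (begin
  N + (b + suc c) * (p * s) + s             ≡⟨ regroup N b (suc c) p s ⟩
  N + s + b * (p * s) + suc c * p * s       ≡⟨ cong₂ (λ l r → l + r * s) eq (sym e≡) ⟩
  y + a * (p * s) + suc e * s               ≡⟨ regroup′ y (a * (p * s)) e s ⟩
  y + e * s + a * (p * s) + s               ∎)
  where
  open ≡-Reasoning
  regroup : ∀ h b c p s → h + (b + c) * (p * s) + s ≡ h + s + b * (p * s) + c * p * s
  regroup = solve-∀
  regroup′ : ∀ y a e s → y + a + suc e * s ≡ y + e * s + a + s
  regroup′ = solve-∀

-- Holes of a partial spread

module Spread {p : ℕ} (K : FieldOnFin (suc p)) {n k v : ℕ}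
  (emb : Fin n → LinearAlgebra.V K k → LinearAlgebra.V K v)
  (emb-linear : ∀ s → LinearAlgebra.IsLinearMap K (emb s))
  (emb-injective : ∀ s {a b} → emb s a ≡ emb s b → a ≡ b)
  (emb-disjoint : ∀ {s t} → s ≢ t → ∀ a b → emb s a ≡ emb t b → emb s a ≡ LinearAlgebra.𝟎 K)
  (1≤n : 1 ≤ n)
  where

  open LinearAlgebra K
  open FieldOnFin K

  private
    q : ℕ
    q = suc p

  cover : V v → ℕ
  cover x = ∑ λ s → ∑ λ a → 𝟙 (emb s a ≟ⱽ x)

  -- Truncated subtraction makes this an indicator of the uncovered vectors. It vanishes at the zero
  -- vector, which is covered n ≥ 1 times.
  hole : V v → ℕ
  hole x = 1 ∸ cover x

  χ : List (V v) → V v → ℕ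
  χ fs x = 𝟙 (killed? fs x) * hole x

  -- η fs counts the nonzero uncovered vectors in the common kernel of fs.  The forms in fs need
  -- not be independent: the congruence below only uses an upper bound on the codimension.
  η : List (V v) → ℕ
  η fs = ∑ (χ fs)

  cover-𝟎 : cover 𝟎 ≡ n
  cover-𝟎 = trans (∑-cong λ s → trans
      (∑-cong λ a → 𝟙-cong (emb s a ≟ⱽ 𝟎) (𝟎 ≟ⱽ a)
        (λ eq → emb-injective s (trans (linear-𝟎 (emb-linear s)) (sym eq)))
        (λ { refl → linear-𝟎 (emb-linear s) }))
      (∑-𝟙≟ _≟ⱽ_ 𝟎))
    (trans (∑-const {A = Fin n} 1) (*-identityʳ n))

  -- Injectivity of an embedding bounds the inner sum by 1, and disjointness of distinct elements
  -- bounds the outer one.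
  cover≤1 : ∀ {x} → x ≢ 𝟎 → cover x ≤ 1
  cover≤1 {x} x≢0 = ∑≤1 _
    (λ s → ∑≤1 _ (λ a → 𝟙≤1 (emb s a ≟ⱽ x)) λ a b a↦x b↦x →
      emb-injective s (trans (𝟙≢0 (emb s a ≟ⱽ x) a↦x) (sym (𝟙≢0 (emb s b ≟ⱽ x) b↦x))))
    same
    where
    same : ∀ s t → ∑ (λ a → 𝟙 (emb s a ≟ⱽ x)) ≢ 0 → ∑ (λ a → 𝟙 (emb t a ≟ⱽ x)) ≢ 0 → s ≡ t
    same s t x∈s x∈t with s Fin.≟ t | ∑≢0 _ x∈s | ∑≢0 _ x∈t
    ... | yes s≡t | _ | _ = s≡t
    ... | no s≢t  | a , a↦x | b , b↦x =
      let sa≡x = 𝟙≢0 (emb s a ≟ⱽ x) a↦x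
          tb≡x = 𝟙≢0 (emb t b ≟ⱽ x) b↦x
      in contradiction (trans (sym sa≡x) (emb-disjoint s≢t a b (trans sa≡x (sym tb≡x)))) x≢0

  hole-𝟎 : hole 𝟎 ≡ 0
  hole-𝟎 = m≤n⇒m∸n≡0 (subst (1 ≤_) (sym cover-𝟎) 1≤n)

  χ≢0 : ∀ fs {x} → χ fs x ≢ 0 → x ≢ 𝟎
  χ≢0 fs χx≢0 refl = χx≢0 (trans (cong (𝟙 (killed? fs 𝟎) *_) hole-𝟎) (*-zeroʳ (𝟙 (killed? fs 𝟎))))

  χ≤1 : ∀ fs x → χ fs x ≤ 1
  χ≤1 fs x = *-mono-≤ (𝟙≤1 (killed? fs x)) (m∸n≤m 1 (cover x))

  -- A nonzero vector is either a hole or covered exactly once. The terms with `𝟙 (𝟎 ≟ⱽ x)` correct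
  -- for the zero vector, which lies in all n elements.
  partition : ∀ x → 1 + n * 𝟙 (𝟎 ≟ⱽ x) ≡ hole x + 𝟙 (𝟎 ≟ⱽ x) + cover x
  partition x with 𝟎 ≟ⱽ x
  ... | yes refl = trans (cong suc (*-identityʳ n)) (sym (cong₂ (λ h c → h + 1 + c) hole-𝟎 cover-𝟎))
  ... | no 0≢x   = begin
    1 + n * 0              ≡⟨ cong suc (*-zeroʳ n) ⟩
    1                      ≡⟨ m∸n+n≡m (cover≤1 (0≢x ∘ sym)) ⟨
    hole x + cover x       ≡⟨ cong (_+ cover x) (+-identityʳ (hole x)) ⟨
    hole x + 0 + cover x   ∎
    where open ≡-Reasoning

  -- Exchanging sums counts incidences from the side of the spread elements, where each parameter
  -- `a` hits exactly one `x`.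
  ∑-cover : ∀ (W : V v → ℕ) → ∑ (λ x → cover x * W x) ≡ ∑ (λ s → ∑ (λ a → W (emb s a)))
  ∑-cover W = begin
    ∑ (λ x → cover x * W x)
      ≡⟨ ∑-cong (λ x → trans (sym (∑-*ʳ (W x) _)) (∑-cong λ s → sym (∑-*ʳ (W x) _))) ⟩
    ∑ (λ x → ∑ λ s → ∑ λ a → 𝟙 (emb s a ≟ⱽ x) * W x)
      ≡⟨ ∑-swap (λ x s → ∑ λ a → 𝟙 (emb s a ≟ⱽ x) * W x) ⟩
    ∑ (λ s → ∑ λ x → ∑ λ a → 𝟙 (emb s a ≟ⱽ x) * W x)
      ≡⟨ ∑-cong (λ s → ∑-swap (λ x a → 𝟙 (emb s a ≟ⱽ x) * W x)) ⟩
    ∑ (λ s → ∑ λ a → ∑ λ x → 𝟙 (emb s a ≟ⱽ x) * W x)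
      ≡⟨ ∑-cong (λ s → ∑-cong λ a → ∑-δ _≟ⱽ_ (emb s a) W) ⟩
    ∑ (λ s → ∑ (λ a → W (emb s a))) ∎
    where open ≡-Reasoning

  -- Multiply `partition` by the indicator of the kernel and sum. The zero vector lies in every
  -- kernel and contributes the n on the left and the 1 on the right.
  count : ∀ fs → # (killed? fs) + n ≡ η fs + 1 + ∑ (λ s → # (killed? fs ∘ emb s))
  count fs = begin
    ∑ W + n
      ≡⟨ cong (∑ W +_) (*-identityʳ n) ⟨
    ∑ W + n * 1
      ≡⟨ cong (λ e → ∑ W + n * e) W-𝟎 ⟨
    ∑ W + n * ∑ (λ x → z x * W x)
      ≡⟨ trans (∑-+ W _) (cong (∑ W +_) (∑-*ˡ n _)) ⟨
    ∑ (λ x → W x + n * (z x * W x))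
      ≡⟨ ∑-cong pointwise ⟩
    ∑ (λ x → W x * hole x + z x * W x + cover x * W x)
      ≡⟨ trans (∑-+ (λ x → W x * hole x + z x * W x) _) (cong₂ _+_ (∑-+ (χ fs) _) (∑-cover W)) ⟩
    η fs + ∑ (λ x → z x * W x) + ∑ (λ s → # (killed? fs ∘ emb s))
      ≡⟨ cong (λ e → η fs + e + ∑ (λ s → # (killed? fs ∘ emb s))) W-𝟎 ⟩
    η fs + 1 + ∑ (λ s → # (killed? fs ∘ emb s)) ∎
    where
    open ≡-Reasoning
    W z : V v → ℕ
    W x = 𝟙 (killed? fs x)
    z x = 𝟙 (𝟎 ≟ⱽ x)

    W-𝟎 : ∑ (λ x → z x * W x) ≡ 1
    W-𝟎 = trans (∑-δ _≟ⱽ_ 𝟎 W) (𝟙-yes (killed? fs 𝟎) (Killed-𝟎 fs))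

    pointwise : ∀ x → W x + n * (z x * W x) ≡ W x * hole x + z x * W x + cover x * W x
    pointwise x = begin
      W x + n * (z x * W x)                      ≡⟨ left n (z x) (W x) ⟩
      (1 + n * z x) * W x                        ≡⟨ cong (_* W x) (partition x) ⟩
      (hole x + z x + cover x) * W x             ≡⟨ right (hole x) (z x) (cover x) (W x) ⟩
      W x * hole x + z x * W x + cover x * W x   ∎
      where
      left : ∀ n z w → w + n * (z * w) ≡ (1 + n * z) * w
      left = solve-∀
      right : ∀ h z c w → (h + z + c) * w ≡ w * h + z * w + c * w
      right = solve-∀

  χ-∷ : ∀ f fs x → χ (f ∷ fs) x ≡ 𝟙 (f ∙ x Fin.≟ 𝟘) * χ fs x
  χ-∷ f fs x = trans (cong (_* hole x) (𝟙-× (f ∙ x Fin.≟ 𝟘) (killed? fs x)))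
    (*-assoc (𝟙 (f ∙ x Fin.≟ 𝟘)) _ _)

  ∑-nonzero : ∑ {A = Fin q} (λ a → 𝟙 (¬? (a Fin.≟ 𝟘))) ≡ p
  ∑-nonzero = +-cancelˡ-≡ 1 _ _ (begin
    1 + ∑ (λ a → 𝟙 (¬? (a Fin.≟ 𝟘)))
      ≡⟨ cong (_+ ∑ (λ a → 𝟙 (¬? (a Fin.≟ 𝟘)))) (∑-𝟙≟ Fin._≟_ 𝟘) ⟨
    ∑ (λ a → 𝟙 (𝟘 Fin.≟ a)) + ∑ (λ a → 𝟙 (¬? (a Fin.≟ 𝟘)))
      ≡⟨ ∑-+ (λ a → 𝟙 (𝟘 Fin.≟ a)) _ ⟨
    ∑ (λ a → 𝟙 (𝟘 Fin.≟ a) + 𝟙 (¬? (a Fin.≟ 𝟘)))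
      ≡⟨ ∑-cong dichotomy ⟩
    ∑ {A = Fin q} (λ _ → 1)
      ≡⟨ trans (∑-const {A = Fin q} 1) (*-identityʳ q) ⟩
    q ∎)
    where
    open ≡-Reasoning
    dichotomy : ∀ a → 𝟙 (𝟘 Fin.≟ a) + 𝟙 (¬? (a Fin.≟ 𝟘)) ≡ 1
    dichotomy a with a Fin.≟ 𝟘
    ... | yes refl = trans (+-identityʳ _) (𝟙-yes (𝟘 Fin.≟ 𝟘) refl)
    ... | no a≢0   = cong (_+ 1) (𝟙-no (𝟘 Fin.≟ a) (a≢0 ∘ sym))

  -- A weight for dependent pairs: at least 1 when `y` is a nonzero multiple of `x`, while its sum
  -- over all holes `y` is at most p, the number of nonzero scalars.
  multiples : V v → V v → ℕ
  multiples x y = ∑ λ a → 𝟙 (¬? (a Fin.≟ 𝟘)) * 𝟙 (scale a x ≟ⱽ y)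

  ∑-multiples : ∀ fs x → ∑ (λ y → χ fs y * multiples x y) ≤ p
  ∑-multiples fs x = begin
    ∑ (λ y → χ fs y * multiples x y)
      ≡⟨ ∑-cong (λ y → trans (sym (∑-*ˡ (χ fs y) _)) (∑-cong λ a → rearrange (χ fs y) (nz a) _)) ⟩
    ∑ (λ y → ∑ λ a → nz a * (𝟙 (scale a x ≟ⱽ y) * χ fs y))
      ≡⟨ ∑-swap (λ y a → nz a * (𝟙 (scale a x ≟ⱽ y) * χ fs y)) ⟩
    ∑ (λ a → ∑ λ y → nz a * (𝟙 (scale a x ≟ⱽ y) * χ fs y))
      ≡⟨ ∑-cong (λ a → trans (∑-*ˡ (nz a) _) (cong (nz a *_) (∑-δ _≟ⱽ_ (scale a x) (χ fs)))) ⟩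
    ∑ (λ a → nz a * χ fs (scale a x))
      ≤⟨ ∑-mono (λ a → ≤-trans (*-monoʳ-≤ (nz a) (χ≤1 fs (scale a x))) (≤-reflexive (*-identityʳ (nz a)))) ⟩
    ∑ nz
      ≡⟨ ∑-nonzero ⟩
    p ∎
    where
    open ≤-Reasoning
    nz : Fin q → ℕ
    nz a = 𝟙 (¬? (a Fin.≟ 𝟘))
    rearrange : ∀ a b c → a * (b * c) ≡ b * (c * a)
    rearrange = solve-∀

  -- Moments of the hole count over all linear forms

  module Moments (T : ℕ) .⦃ T≢0 : NonZero T ⦄ (q²T≡qᵛ : q * (q * T) ≡ q ^ v) where

    -- `T` is q^(v - 2), the number of forms that vanish on two independent vectors; q T forms
    -- vanish on a single nonzero vector.
    orthogonal : ∀ {x} → x ≢ 𝟎 → # (λ f → f ∙ x Fin.≟ 𝟘) ≡ q * T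
    orthogonal x≢0 = *-cancelˡ-≡ _ _ q (trans (sym (#-orthogonal {v} x≢0)) (sym q²T≡qᵛ))

    -- Independent pairs have exactly `T` common annihilators. For proportional ones the number is q
    -- T = T + p T, and the surplus is paid for by `multiples x y` ≥ 1.
    orthogonal₂ : ∀ {x y} → x ≢ 𝟎 → y ≢ 𝟎 →
      # (λ f → (f ∙ y Fin.≟ 𝟘) ×-dec (f ∙ x Fin.≟ 𝟘)) ≤ T + p * T * multiples x y
    orthogonal₂ {x} {y} x≢0 y≢0 with #-orthogonal₂ {y = y} x≢0
    ... | inj₂ split = ≤-trans (≤-reflexive (*-cancelˡ-≡ _ T q (trans (sym split) (orthogonal x≢0)))) (m≤m+n T _)
    ... | inj₁ (a , refl) = begin
      # (λ f → (f ∙ y Fin.≟ 𝟘) ×-dec (f ∙ x Fin.≟ 𝟘))  ≤⟨ ∑-mono weaken ⟩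
      # (λ f → f ∙ x Fin.≟ 𝟘)                          ≡⟨ orthogonal x≢0 ⟩
      T + p * T                                        ≡⟨ cong (T +_) (*-identityʳ (p * T)) ⟨
      T + p * T * 1                                    ≤⟨ +-monoʳ-≤ T (*-monoʳ-≤ (p * T) one≤) ⟩
      T + p * T * multiples x y                        ∎
      where
      open ≤-Reasoning
      a≢0 : a ≢ 𝟘
      a≢0 refl = y≢0 (scale-𝟘 x)

      weaken : ∀ f → 𝟙 ((f ∙ y Fin.≟ 𝟘) ×-dec (f ∙ x Fin.≟ 𝟘)) ≤ 𝟙 (f ∙ x Fin.≟ 𝟘)
      weaken f = ≤-trans (≤-reflexive (𝟙-× (f ∙ y Fin.≟ 𝟘) (f ∙ x Fin.≟ 𝟘)))
        (≤-trans (*-monoˡ-≤ _ (𝟙≤1 (f ∙ y Fin.≟ 𝟘))) (≤-reflexive (*-identityˡ _)))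

      one≤ : 1 ≤ multiples x y
      one≤ = subst (_≤ multiples x y)
        (cong₂ _*_ (𝟙-yes (¬? (a Fin.≟ 𝟘)) a≢0) (𝟙-yes (scale a x ≟ⱽ y) refl))
        (term≤∑ Fin._≟_ (λ b → 𝟙 (¬? (b Fin.≟ 𝟘)) * 𝟙 (scale b x ≟ⱽ y)) a)

    -- A hole in the kernel of `fs` survives for exactly the q T forms that vanish on it.
    first-moment : ∀ fs → ∑ (λ f → η (f ∷ fs)) ≡ η fs * (q * T)
    first-moment fs = begin
      ∑ (λ f → ∑ (χ (f ∷ fs)))
        ≡⟨ ∑-swap (λ f → χ (f ∷ fs)) ⟩
      ∑ (λ x → ∑ λ f → χ (f ∷ fs) x)
        ≡⟨ ∑-cong (λ x → trans (∑-cong λ f → χ-∷ f fs x) (∑-*ʳ (χ fs x) _)) ⟩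
      ∑ (λ x → # (λ f → f ∙ x Fin.≟ 𝟘) * χ fs x)
        ≡⟨ ∑-cong same ⟩
      ∑ (λ x → χ fs x * (q * T))
        ≡⟨ ∑-*ʳ (q * T) (χ fs) ⟩
      η fs * (q * T) ∎
      where
      open ≡-Reasoning
      same : ∀ x → # (λ f → f ∙ x Fin.≟ 𝟘) * χ fs x ≡ χ fs x * (q * T)
      same x with χ fs x ≟ 0
      ... | yes χ≡0 = trans (cong (# (λ f → f ∙ x Fin.≟ 𝟘) *_) χ≡0)
                        (trans (*-zeroʳ (# (λ f → f ∙ x Fin.≟ 𝟘))) (sym (cong (_* (q * T)) χ≡0)))
      ... | no χ≢   = trans (cong (_* χ fs x) (orthogonal (χ≢0 fs χ≢))) (*-comm (q * T) _)

    -- The squares count ordered pairs of holes killed by `f`. By `orthogonal₂` each pair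
    -- contributes at most `T` plus a surplus for proportionality, and for a fixed first hole the
    -- surpluses add up to at most p T p.
    second-moment : ∀ fs → ∑ (λ f → η (f ∷ fs) * η (f ∷ fs)) ≤ η fs * (η fs * T + p * T * p)
    second-moment fs = begin
      ∑ (λ f → η (f ∷ fs) * η (f ∷ fs))
        ≡⟨ ∑-cong expand ⟩
      ∑ (λ f → ∑ λ x → ∑ λ y → χ fs x * (χ fs y * both f x y))
        ≡⟨ ∑-swap (λ f x → ∑ λ y → χ fs x * (χ fs y * both f x y)) ⟩
      ∑ (λ x → ∑ λ f → ∑ λ y → χ fs x * (χ fs y * both f x y))
        ≡⟨ ∑-cong (λ x → ∑-swap (λ f y → χ fs x * (χ fs y * both f x y))) ⟩
      ∑ (λ x → ∑ λ y → ∑ λ f → χ fs x * (χ fs y * both f x y))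
        ≡⟨ ∑-cong (λ x → ∑-cong λ y → trans (∑-*ˡ (χ fs x) _) (cong (χ fs x *_) (∑-*ˡ (χ fs y) _))) ⟩
      ∑ (λ x → ∑ λ y → χ fs x * (χ fs y * ∑ (λ f → both f x y)))
        ≤⟨ ∑-mono (λ x → ∑-mono λ y → bound x y) ⟩
      ∑ (λ x → ∑ λ y → χ fs x * (χ fs y * (T + p * T * multiples x y)))
        ≡⟨ ∑-cong (λ x → trans (∑-*ˡ (χ fs x) _) (cong (χ fs x *_) (split x))) ⟩
      ∑ (λ x → χ fs x * (η fs * T + p * T * ∑ (λ y → χ fs y * multiples x y)))
        ≤⟨ ∑-mono (λ x → *-monoʳ-≤ (χ fs x) (+-monoʳ-≤ (η fs * T) (*-monoʳ-≤ (p * T) (∑-multiples fs x)))) ⟩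
      ∑ (λ x → χ fs x * (η fs * T + p * T * p))
        ≡⟨ ∑-*ʳ (η fs * T + p * T * p) (χ fs) ⟩
      η fs * (η fs * T + p * T * p) ∎
      where
      open ≤-Reasoning
      both : V v → V v → V v → ℕ
      both f x y = 𝟙 ((f ∙ y Fin.≟ 𝟘) ×-dec (f ∙ x Fin.≟ 𝟘))

      expand : ∀ f → η (f ∷ fs) * η (f ∷ fs) ≡ ∑ (λ x → ∑ λ y → χ fs x * (χ fs y * both f x y))
      expand f = trans (sym (∑-*ʳ (η (f ∷ fs)) (χ (f ∷ fs)))) (∑-cong λ x →
        trans (sym (∑-*ˡ (χ (f ∷ fs) x) (χ (f ∷ fs)))) (∑-cong λ y →
        trans (cong₂ _*_ (χ-∷ f fs x) (χ-∷ f fs y))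
          (trans (rearrange (𝟙 (f ∙ x Fin.≟ 𝟘)) (χ fs x) (𝟙 (f ∙ y Fin.≟ 𝟘)) (χ fs y))
            (cong (λ e → χ fs x * (χ fs y * e)) (sym (𝟙-× (f ∙ y Fin.≟ 𝟘) (f ∙ x Fin.≟ 𝟘)))))))
        where
        rearrange : ∀ a b c d → (a * b) * (c * d) ≡ b * (d * (c * a))
        rearrange = solve-∀

      bound : ∀ x y → χ fs x * (χ fs y * ∑ (λ f → both f x y))
                    ≤ χ fs x * (χ fs y * (T + p * T * multiples x y))
      bound x y with χ fs x ≟ 0 | χ fs y ≟ 0
      ... | yes x≡0 | _ = ≤-trans (≤-reflexive (cong (_* (χ fs y * ∑ (λ f → both f x y))) x≡0)) z≤n
      ... | no _ | yes y≡0 = *-monoʳ-≤ (χ fs x)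
        (≤-trans (≤-reflexive (cong (_* ∑ (λ f → both f x y)) y≡0)) z≤n)
      ... | no x≢ | no y≢ = *-monoʳ-≤ (χ fs x) (*-monoʳ-≤ (χ fs y)
        (orthogonal₂ (χ≢0 fs x≢) (χ≢0 fs y≢)))

      split : ∀ x → ∑ (λ y → χ fs y * (T + p * T * multiples x y))
                  ≡ η fs * T + p * T * ∑ (λ y → χ fs y * multiples x y)
      split x = trans (∑-cong λ y → distrib (χ fs y) T (p * T) (multiples x y))
        (trans (∑-+ (λ y → χ fs y * T) _) (cong₂ _+_ (∑-*ʳ T (χ fs)) (∑-*ˡ (p * T) _)))
        where
        distrib : ∀ a t s m → a * (t + s * m) ≡ a * t + s * (a * m)
        distrib = solve-∀

    ∑-const-V : ∀ c → ∑ {A = V v} (λ _ → c) ≡ q * (q * T) * c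
    ∑-const-V c = trans (∑-const {A = V v} c) (cong (_* c) (trans (card-Vec {A = Fin q} v) (sym q²T≡qᵛ)))

    -- If q N ≥ η + 1 held for all q² T forms, summation and the first moment would give q² T η ≥ q²
    -- T (η + 1).
    average : ∀ fs → ∃ λ f → q * η (f ∷ fs) ≤ η fs
    average fs with ∃? (λ f → q * η (f ∷ fs) ≤? η fs)
    ... | yes found = found
    ... | no none   = contradiction (*-cancelˡ-≤ {suc (η fs)} (q * (q * T)) (begin
        q * (q * T) * suc (η fs)          ≡⟨ ∑-const-V (suc (η fs)) ⟨
        ∑ {A = V v} (λ _ → suc (η fs))    ≤⟨ ∑-mono (λ f → ≰⇒> (λ le → none (f , le))) ⟩
        ∑ (λ f → q * η (f ∷ fs))          ≡⟨ trans (∑-*ˡ q _) (cong (q *_) (first-moment fs)) ⟩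
        q * (η fs * (q * T))              ≡⟨ rearrange q (η fs) T ⟩
        q * (q * T) * η fs                ∎)) 1+n≰n
      where
      open ≤-Reasoning
      instance
        q²T≢0 : NonZero (q * (q * T))
        q²T≢0 = m*n≢0 q (q * T) ⦃ _ ⦄ ⦃ m*n≢0 q T ⦄
      rearrange : ∀ q h T → q * (h * (q * T)) ≡ q * (q * T) * h
      rearrange = solve-∀

    -- Sum `square-bound` over all forms, insert both moments and cancel the common factor `T`.
    variance : ∀ fs A B → (∀ f → ∃₂ λ a b → η (f ∷ fs) + a * B ≡ A + b * B) →
      2 * A * η fs * q + A * B * (q * q) ≤ η fs * (η fs + p * p) + A * A * (q * q) + B * η fs * q
    variance fs A B cong-B = *-cancelʳ-≤ _ _ T (begin
      (2 * A * h * q + A * B * (q * q)) * T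
        ≡⟨ lhs A B h q T ⟩
      2 * A * (h * (q * T)) + q * (q * T) * (A * B)
        ≡⟨ cong₂ _+_ (cong (2 * A *_) (first-moment fs)) (∑-const-V (A * B)) ⟨
      2 * A * ∑ N + ∑ {A = V v} (λ _ → A * B)
        ≡⟨ trans (∑-+ (λ f → 2 * A * N f) _) (cong (_+ ∑ {A = V v} (λ _ → A * B)) (∑-*ˡ (2 * A) N)) ⟨
      ∑ (λ f → 2 * A * N f + A * B)
        ≤⟨ ∑-mono (λ f → let a , b , eq = cong-B f in square-bound B a b eq) ⟩
      ∑ (λ f → N f * N f + A * A + B * N f)
        ≡⟨ trans (∑-+ (λ f → N f * N f + A * A) _) (cong₂ _+_ (∑-+ (λ f → N f * N f) _) (∑-*ˡ B N)) ⟩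
      ∑ (λ f → N f * N f) + ∑ {A = V v} (λ _ → A * A) + B * ∑ N
        ≤⟨ +-mono-≤ (+-mono-≤ (second-moment fs) (≤-reflexive (∑-const-V (A * A))))
                    (≤-reflexive (cong (B *_) (first-moment fs))) ⟩
      h * (h * T + p * T * p) + q * (q * T) * (A * A) + B * (h * (q * T))
        ≡⟨ rhs A B h q T p ⟩
      (h * (h + p * p) + A * A * (q * q) + B * h * q) * T ∎)
      where
      open ≤-Reasoning
      h : ℕ
      h = η fs
      N : V v → ℕ
      N f = η (f ∷ fs)
      lhs : ∀ A B h q T → (2 * A * h * q + A * B * (q * q)) * T ≡ 2 * A * (h * (q * T)) + q * (q * T) * (A * B)
      lhs = solve-∀
      rhs : ∀ A B h q T p → h * (h * T + p * T * p) + q * (q * T) * (A * A) + B * (h * (q * T))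
                          ≡ (h * (h + p * p) + A * A * (q * q) + B * h * q) * T
      rhs = solve-∀

    -- Congruence, descent and contradiction

    module Excess .⦃ p≢0 : NonZero p ⦄ (z l : ℕ) (k≤v : k ≤ v)
      (n≡ : n ≡ l * q ^ k + 1 + (1 + z * p)) where

      private
        y : ℕ
        y = 1 + z * p

      congruence : ∀ fs i → i + length fs ≡ k →
        ∃₂ λ α β → η fs + q ^ i + β * (p * q ^ i) ≡ y + α * (p * q ^ i)
      congruence fs i i+j≡k =
        α + l * γ , l * δ + z + ∑ β ,
        congruence-arith {η fs} {n} {p} {l} {z} {q ^ i} {q ^ k} α (∑ β) γ δ
          n≡ Q≡ Q≡′ W≡ U≡ (count fs)
        where
        -- The ambient space has dimension v, so the kernel has dimension at least v - j = i + (v -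
        -- k), where j is the length of `fs`.
        W = #-killed {L = id} (λ _ _ _ → refl) fs (i + (v ∸ k)) (begin
          i + (v ∸ k) + length fs    ≡⟨ swap i (v ∸ k) (length fs) ⟩
          v ∸ k + (i + length fs)    ≡⟨ cong (v ∸ k +_) i+j≡k ⟩
          v ∸ k + k                  ≡⟨ m∸n+n≡m k≤v ⟩
          v                          ∎)
          where
          open ≡-Reasoning
          swap : ∀ a b c → a + b + c ≡ b + (a + c)
          swap = solve-∀
        U = λ s → #-killed (emb-linear s) fs i i+j≡k
        W-split = ^-split p i (v ∸ k + proj₁ W)
        U-split = λ s → ^-split p i (proj₁ (U s))
        α = proj₁ W-split
        β = λ s → proj₁ (U-split s)
        γ = proj₁ (^-split p i (length fs))
        δ = proj₁ (^-geometric p k)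

        Q≡ : q ^ k ≡ q ^ i + γ * (p * q ^ i)
        Q≡ = trans (cong (q ^_) (sym i+j≡k)) (proj₂ (^-split p i (length fs)))
        Q≡′ : q ^ k ≡ 1 + δ * p
        Q≡′ = proj₂ (^-geometric p k)
        W≡ : # (killed? fs) ≡ q ^ i + α * (p * q ^ i)
        W≡ = trans (proj₂ W) (trans (cong (q ^_) (+-assoc i (v ∸ k) (proj₁ W))) (proj₂ W-split))
        U≡ : ∑ (λ s → # (killed? fs ∘ emb s)) ≡ n * q ^ i + ∑ β * (p * q ^ i)
        U≡ = trans (∑-cong λ s → trans (proj₂ (U s)) (proj₂ (U-split s)))
          (trans (∑-+ (λ _ → q ^ i) _) (cong₂ _+_ (∑-const {A = Fin n} (q ^ i)) (∑-*ʳ (p * q ^ i) β)))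

      descend-step : ∀ fs C i → i + suc (length fs) ≡ k →
        η fs + q ^ suc i ≤ suc C * (p * q ^ suc i) + y →
        ∃ λ f → η (f ∷ fs) + q ^ i ≤ C * (p * q ^ i) + y
      descend-step fs C i i+j≡k bound =
        let f , f≤ = average fs
            α , β , eq = congruence (f ∷ fs) i i+j≡k
        in f , descent-arith {η (f ∷ fs)} {η fs} {y} {C} {q ^ i} p α β f≤ bound eq

      -- Once the coefficient is down to `z`, one more form is averaged over instead of chosen. The
      -- exponent `suc i` belongs to `fs` and `i` to the kernels `f ∷ fs`, which fixes A = y + e qⁱ
      -- and B = p qⁱ.
      no-small-excess : ∀ fs i → suc i + length fs ≡ k → y * y + y < 2 * q ^ suc i →
        ¬ (η fs + q ^ suc i ≤ z * (p * q ^ suc i) + y)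
      no-small-excess fs i i+j≡k y²+y< bound =
        let α , β , eq = congruence fs (suc i) i+j≡k
            c , e , e≡ , η≡ = excess-form p {η fs} {y} {q ^ suc i} α β (y<X {y} {q ^ suc i} y²+y<) eq
        in <⇒≱ y²+y< (contradiction-arith p {z} {η fs} {e} {q ^ i} η≡ bound
             (variance fs (y + e * q ^ i) (p * q ^ i) λ f →
               let a , b , eq′ = congruence (f ∷ fs) i (trans (+-suc i (length fs)) i+j≡k)
               in b + suc c , a , congruence-shift {η (f ∷ fs)} {y} {p} {q ^ i} {c} {e} a b e≡ eq′))

      module _ {C₀ R : ℕ} (R≡ : R ≡ 1 + (z + C₀) * p)
               (qᵛ≡ : q ^ v + l * q ^ k ≡ l * q ^ k * q ^ k + R * q ^ k) where

        base : η [] + q ^ k ≡ C₀ * (p * q ^ k) + y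
        base = base-arith {η []} {n} {p} {l} {z} {C₀} {q ^ k} n≡ qᵛ≡ R≡ (begin
          q ^ v + n                                        ≡⟨ cong (_+ n) (#-all {v}) ⟨
          # (killed? []) + n                               ≡⟨ count [] ⟩
          η [] + 1 + ∑ (λ s → # (killed? [] ∘ emb s))      ≡⟨ cong (η [] + 1 +_) (trans (∑-cong {A = Fin n} (λ _ → #-all {k})) (∑-const {A = Fin n} (q ^ k))) ⟩
          η [] + 1 + n * q ^ k                             ∎)
          where open ≡-Reasoning

        -- Each chosen form lowers the exponent and the coefficient by one, so i + j and C + j stay
        -- equal to `k` and `C₀`.
        descend : ∀ j C i → i + j ≡ k → C + j ≡ C₀ →
          ∃ λ fs → length fs ≡ j × η fs + q ^ i ≤ C * (p * q ^ i) + y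
        descend zero C i i≡k C≡C₀ = [] , refl ,
          subst₂ (λ i C → η [] + q ^ i ≤ C * (p * q ^ i) + y)
            (trans (sym i≡k) (+-identityʳ i)) (trans (sym C≡C₀) (+-identityʳ C)) (≤-reflexive base)
        descend (suc j) C i i≡k C≡C₀ =
          let fs , j≡ , bound = descend j (suc C) (suc i) (trans (sym (+-suc i j)) i≡k) (trans (sym (+-suc C j)) C≡C₀)
              f , bound′ = descend-step fs C i (trans (cong (λ j → i + suc j) j≡) i≡k) bound
          in f ∷ fs , cong suc j≡ , bound′

        -- The descent stops after j = C₀ - z forms, when the coefficient equals `z`.
        impossible : ∀ i j → k ≡ suc i + j → C₀ ≡ z + j → ¬ (y * y + y < 2 * q ^ suc i)
        impossible i j k≡ C₀≡ y²+y< =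
          let fs , j≡ , bound = descend j z (suc i) (sym k≡) (sym C₀≡)
          in no-small-excess fs i (trans (cong (suc i +_) j≡) (sym k≡)) y²+y< bound

-- Transport of an arbitrary finite field to Fin q

module Transport {c ℓ : Level} {q : ℕ} (F : FiniteField c ℓ q) where
  private module F = FiniteField F
  open F using (Carrier; _≈_; 0#; 1#; enum; enum-injective; enum-surjective)
    renaming (_+_ to infixl 6 _+ᶠ_; _*_ to infixl 7 _*ᶠ_; refl to ≈-refl; sym to ≈-sym; trans to ≈-trans)

  index : Carrier → Fin q
  index x = proj₁ (enum-surjective x)

  enum-index : ∀ x → enum (index x) ≈ x
  enum-index x = proj₂ (enum-surjective x)

  index-cong : ∀ {x y} → x ≈ y → index x ≡ index y
  index-cong x≈y = enum-injective _ _ (≈-trans (enum-index _) (≈-trans x≈y (≈-sym (enum-index _))))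

  index-enum : ∀ i → index (enum i) ≡ i
  index-enum i = enum-injective _ _ (enum-index (enum i))

  rawRingOnFin : RawRing 0ℓ 0ℓ
  rawRingOnFin = record
    { Carrier = Fin q
    ; _≈_     = _≡_
    ; _+_     = λ i j → index (enum i +ᶠ enum j)
    ; _*_     = λ i j → index (enum i *ᶠ enum j)
    ; -_      = λ i → index (F.- enum i)
    ; 0#      = index 0#
    ; 1#      = index 1#
    }

  -- Being injective and compatible with the operations, `enum` pulls the ring laws of the given
  -- field back to `Fin q`.
  enum-isRingMonomorphism : IsRingMonomorphism rawRingOnFin F.rawRing enum
  enum-isRingMonomorphism = record
    { isRingHomomorphism = record
      { isSemiringHomomorphism = record
        { isNearSemiringHomomorphism = record
          { +-isMonoidHomomorphism = record
            { isMagmaHomomorphism = record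
              { isRelHomomorphism = record { cong = λ { refl → ≈-refl } }
              ; homo              = λ _ _ → enum-index _
              }
            ; ε-homo = enum-index _
            }
          ; *-homo = λ _ _ → enum-index _
          }
        ; 1#-homo = enum-index _
        }
      ; -‿homo = λ _ → enum-index _
      }
    ; injective = enum-injective _ _
    }

  fieldOnFin : FieldOnFin q
  fieldOnFin = record
    { isCommutativeRing = RingMonomorphism.isCommutativeRing enum-isRingMonomorphism F.isCommutativeRing
    ; invert = λ i i≢0 →
        let y , iy≈1 = F.inverse (enum i) λ i≈0 → i≢0 (trans (sym (index-enum i)) (index-cong i≈0))
        in index y , index-cong (≈-trans (F.*-congˡ (enum-index y)) iy≈1)
    }

  open FieldOnFin fieldOnFin using (_⊕_; _⊛_; 𝟘; 𝟙ᴷ; ⊖_)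
  open LinearAlgebra fieldOnFin

  lookup-injective : ∀ {A : Set} {d} (x y : Vec A d) → (∀ i → lookup x i ≡ lookup y i) → x ≡ y
  lookup-injective x y eq = trans (sym (tabulate∘lookup x)) (trans (tabulate-cong eq) (tabulate∘lookup y))

  coords : ∀ {d} → V d → Fin d → Carrier
  coords a i = enum (lookup a i)

  coords-injective : ∀ {d} (x y : V d) → (∀ i → coords x i ≈ coords y i) → x ≡ y
  coords-injective x y eq = lookup-injective x y λ i → enum-injective _ _ (eq i)

  coords-𝟎 : ∀ {d} (i : Fin d) → coords 𝟎 i ≈ 0#
  coords-𝟎 {d} i = ≈-trans (F.reflexive (cong enum (lookup-replicate i 𝟘))) (enum-index 0#)

  coords-+[] : ∀ {d} (x : V d) b w i → coords (x +[ b ] w) i ≈ coords x i +ᶠ enum b *ᶠ coords w i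
  coords-+[] x b w i = ≈-trans (F.reflexive (cong enum (lookup-zipWith _ i x w)))
    (≈-trans (enum-index _) (F.+-congˡ (enum-index _)))

  sumF-linear : ∀ {d} (f g h B : Fin d → Carrier) b → (∀ i → h i ≈ f i +ᶠ b *ᶠ g i) →
    sumF F (λ i → h i *ᶠ B i) ≈ sumF F (λ i → f i *ᶠ B i) +ᶠ b *ᶠ sumF F (λ i → g i *ᶠ B i)
  sumF-linear {zero}  f g h B b h≈ = ≈-sym (≈-trans (F.+-identityˡ _) (F.zeroʳ b))
  sumF-linear {suc d} f g h B b h≈ = begin
    h zero *ᶠ B zero +ᶠ sumF F (λ i → h (suc i) *ᶠ B (suc i))
      ≈⟨ F.+-cong (F.*-congʳ (h≈ zero)) (sumF-linear (f ∘ suc) (g ∘ suc) (h ∘ suc) (B ∘ suc) b (h≈ ∘ suc)) ⟩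
    (f zero +ᶠ b *ᶠ g zero) *ᶠ B zero +ᶠ (s +ᶠ b *ᶠ t)
      ≈⟨ F.+-congʳ (≈-trans (F.distribʳ _ _ _) (F.+-congˡ (F.*-assoc b (g zero) (B zero)))) ⟩
    (f zero *ᶠ B zero +ᶠ b *ᶠ (g zero *ᶠ B zero)) +ᶠ (s +ᶠ b *ᶠ t)
      ≈⟨ F.+-assoc _ _ _ ⟩
    f zero *ᶠ B zero +ᶠ (b *ᶠ (g zero *ᶠ B zero) +ᶠ (s +ᶠ b *ᶠ t))
      ≈⟨ F.+-congˡ (≈-trans (≈-sym (F.+-assoc _ _ _)) (≈-trans (F.+-congʳ (F.+-comm _ _)) (F.+-assoc _ _ _))) ⟩
    f zero *ᶠ B zero +ᶠ (s +ᶠ (b *ᶠ (g zero *ᶠ B zero) +ᶠ b *ᶠ t))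
      ≈⟨ F.+-assoc _ _ _ ⟨
    (f zero *ᶠ B zero +ᶠ s) +ᶠ (b *ᶠ (g zero *ᶠ B zero) +ᶠ b *ᶠ t)
      ≈⟨ F.+-congˡ (F.distribˡ b _ _) ⟨
    (f zero *ᶠ B zero +ᶠ s) +ᶠ b *ᶠ (g zero *ᶠ B zero +ᶠ t) ∎
    where
    open Relation.Binary.Reasoning.Setoid F.setoid
    s t : Carrier
    s = sumF F (λ i → f (suc i) *ᶠ B (suc i))
    t = sumF F (λ i → g (suc i) *ᶠ B (suc i))

  module _ {k v : ℕ} (B : Fin k → Vector F v) where

    span : V k → V v
    span a = tabulate λ j → index (lincomb F B (coords a) j)

    coords-span : ∀ a j → coords (span a) j ≈ lincomb F B (coords a) j
    coords-span a j = ≈-trans (F.reflexive (cong enum (lookup∘tabulate _ j))) (enum-index _)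

    span-linear : IsLinearMap span
    span-linear x b w = coords-injective (span (x +[ b ] w)) (span x +[ b ] span w) λ j → begin
      coords (span (x +[ b ] w)) j                                 ≈⟨ coords-span (x +[ b ] w) j ⟩
      lincomb F B (coords (x +[ b ] w)) j                          ≈⟨ sumF-linear (coords x) (coords w) (coords (x +[ b ] w)) (λ i → B i j) (enum b) (coords-+[] x b w) ⟩
      lincomb F B (coords x) j +ᶠ enum b *ᶠ lincomb F B (coords w) j ≈⟨ F.+-cong (coords-span x j) (F.*-congˡ (coords-span w j)) ⟨
      coords (span x) j +ᶠ enum b *ᶠ coords (span w) j               ≈⟨ coords-+[] (span x) b (span w) j ⟨
      coords (span x +[ b ] span w) j                              ∎
      where open Relation.Binary.Reasoning.Setoid F.setoid

    span≡𝟎 : ∀ a → (_≈ᵥ_ F (lincomb F B (coords a)) (zeroVec F)) → span a ≡ 𝟎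
    span≡𝟎 a eq = coords-injective (span a) 𝟎 λ j →
      ≈-trans (coords-span a j) (≈-trans (eq j) (≈-sym (coords-𝟎 j)))

    -- The difference of two coefficient vectors with equal image is a vanishing combination of the
    -- basis, so it is zero by independence.
    span-injective : LinIndep F B → ∀ {a b} → span a ≡ span b → a ≡ b
    span-injective indep {a} {b} eq = -ⱽ≡𝟎⇒≡ a b (coords-injective (a -ⱽ b) 𝟎 λ i →
      ≈-trans (indep (coords (a -ⱽ b)) vanish i) (≈-sym (coords-𝟎 i)))
      where
      span-diff : span (a -ⱽ b) ≡ 𝟎
      span-diff = trans (span-linear a _ b) (trans (cong (_-ⱽ span b) eq) (-ⱽ-self (span b)))
      vanish : ∀ j → lincomb F B (coords (a -ⱽ b)) j ≈ 0#
      vanish j = ≈-trans (≈-sym (coords-span (a -ⱽ b) j))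
        (≈-trans (F.reflexive (cong (λ x → coords x j) span-diff)) (coords-𝟎 j))

  span-disjoint : ∀ {k v} {B C : Fin k → Vector F v} → TrivialIntersection F B C →
    ∀ a b → span B a ≡ span C b → span B a ≡ 𝟎
  span-disjoint {B = B} {C} trivial a b eq = span≡𝟎 B a (trivial (coords a) (coords b) λ j →
    ≈-trans (≈-sym (coords-span B a j))
      (≈-trans (F.reflexive (cong (λ x → coords x j) eq)) (coords-span C b j)))

-- From the numerical parameters to the bound

q^v-arith : ∀ p k w r l .⦃ _ : NonZero p ⦄ → r ≤ w → let q = suc p in
  l * (q ^ k ∸ 1) ≡ q ^ w ∸ q ^ r →
  q ^ (k + w) + l * q ^ k ≡ l * q ^ k * q ^ k + q ^ r * q ^ k
q^v-arith p k w r l r≤w eq = begin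
  q ^ (k + w) + l * Q             ≡⟨ cong (_+ l * Q) (^-distribˡ-+-* q k w) ⟩
  Q * q ^ w + l * Q               ≡⟨ factor Q (q ^ w) l ⟩
  (q ^ w + l) * Q                 ≡⟨ cong (_* Q) unsubtracted ⟨
  (l * Q + q ^ r) * Q             ≡⟨ *-distribʳ-+ Q (l * Q) (q ^ r) ⟩
  l * Q * Q + q ^ r * Q           ∎
  where
  open ≡-Reasoning
  q Q : ℕ
  q = suc p
  Q = q ^ k
  factor : ∀ Q W l → Q * W + l * Q ≡ (W + l) * Q
  factor = solve-∀
  assoc : ∀ l a b → l * (a + 1) + b ≡ l * a + b + l
  assoc = solve-∀
  -- Both truncated subtractions in `eq` are genuine, because qᵏ ≥ 1 and r ≤ w.
  unsubtracted : l * Q + q ^ r ≡ q ^ w + l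
  unsubtracted = begin
    l * Q + q ^ r                   ≡⟨ cong (λ e → l * e + q ^ r) (m∸n+n≡m (m^n>0 q k)) ⟨
    l * (Q ∸ 1 + 1) + q ^ r         ≡⟨ assoc l (Q ∸ 1) (q ^ r) ⟩
    l * (Q ∸ 1) + q ^ r + l         ≡⟨ cong (λ e → e + q ^ r + l) eq ⟩
    q ^ w ∸ q ^ r + q ^ r + l       ≡⟨ cong (_+ l) (m∸n+n≡m (^-monoʳ-≤ q r≤w)) ⟩
    q ^ w + l                       ∎

-- The family has exactly one member more than the bound allows, that is l qᵏ + 1 + y with y = 1 + z
-- p.
no-large-spread : ∀ {c ℓ} p .⦃ _ : NonZero p ⦄ (F : FiniteField c ℓ (suc p)) r t u z m l →
  1 ≤ r → let k = m + 1 ∸ z + u ; v = k * (2 + t) + r ; q = suc p in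
  m * p ≡ q ^ r ∸ 1 → 2 * z ≤ m →
  l * (q ^ k ∸ 1) ≡ q ^ (v ∸ k) ∸ q ^ r →
  ∀ (S : Fin (l * q ^ k + 1 + (1 + z * p)) → Fin k → Fin v → FiniteField.Carrier F) →
  ¬ IsPartialSpread F S
no-large-spread p F r t u z m l 1≤r m≡ 2z≤m l≡ S (indep , trivial) =
  -- With C₀ = m - z and j = m - 2 z forms, the final exponent is k - j = z + 1 + u.
  impossible {C₀ = z + j} R≡ qᵛ≡ (z + u) j k≡ refl
    (subst (λ i → (1 + z * p) * (1 + z * p) + (1 + z * p) < 2 * q ^ i) (shift z u) (y²+y<2qⁱ p z u))
  where
  open ≡-Reasoning
  q k v w j : ℕ
  q = suc p
  k = m + 1 ∸ z + u
  v = k * (2 + t) + r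
  w = k * (1 + t) + r
  j = m ∸ 2 * z

  shift : ∀ z u → z + 1 + u ≡ suc (z + u)
  shift = solve-∀

  m≡z+ : m ≡ z + (z + j)
  m≡z+ = trans (sym (m+[n∸m]≡n 2z≤m)) (double z j)
    where
    double : ∀ z j → 2 * z + j ≡ z + (z + j)
    double = solve-∀

  k≡ : k ≡ suc (z + u) + j
  k≡ = begin
    m + 1 ∸ z + u                  ≡⟨ cong (λ m → m + 1 ∸ z + u) m≡z+ ⟩
    z + (z + j) + 1 ∸ z + u        ≡⟨ cong (λ e → e ∸ z + u) (+-assoc z (z + j) 1) ⟩
    z + (z + j + 1) ∸ z + u        ≡⟨ cong (_+ u) (m+n∸m≡n z (z + j + 1)) ⟩
    z + j + 1 + u                  ≡⟨ rearrange z j u ⟩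
    suc (z + u) + j                ∎
    where
    rearrange : ∀ z j u → z + j + 1 + u ≡ suc (z + u) + j
    rearrange = solve-∀

  R≡ : q ^ r ≡ 1 + (z + (z + j)) * p
  R≡ = begin
    q ^ r                        ≡⟨ m+[n∸m]≡n (m^n>0 q r) ⟨
    1 + (q ^ r ∸ 1)              ≡⟨ cong suc m≡ ⟨
    1 + m * p                    ≡⟨ cong (λ m → 1 + m * p) m≡z+ ⟩
    1 + (z + (z + j)) * p        ∎

  v≡ : v ≡ k + w
  v≡ = expand k t r
    where
    expand : ∀ k t r → k * (2 + t) + r ≡ k + (k * (1 + t) + r)
    expand = solve-∀

  qᵛ≡ : q ^ v + l * q ^ k ≡ l * q ^ k * q ^ k + q ^ r * q ^ k
  qᵛ≡ = subst (λ v → q ^ v + l * q ^ k ≡ l * q ^ k * q ^ k + q ^ r * q ^ k) (sym v≡)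
    (q^v-arith p k w r l (m≤n+m r (k * (1 + t)))
      (trans l≡ (cong (λ e → q ^ e ∸ q ^ r) (trans (cong (_∸ k) v≡) (m+n∸m≡n k w)))))

  -- Both k and r are positive, so v - 2 is a genuine difference and `T` can be taken as q^(v - 2).
  2≤v : 2 ≤ v
  2≤v = subst (2 ≤_) (sym v≡)
    (+-mono-≤ (subst (1 ≤_) (sym k≡) (s≤s z≤n)) (≤-trans 1≤r (m≤n+m r (k * (1 + t)))))

  open Transport F
  open Spread fieldOnFin (λ s → span (S s)) (λ s → span-linear (S s))
    (λ s → span-injective (S s) (indep s)) (λ s≢t → span-disjoint (trivial _ _ s≢t))
    (≤-trans (s≤s z≤n) (m≤n+m (1 + z * p) (l * q ^ k + 1)))
  open Moments (q ^ (v ∸ 2)) ⦃ m^n≢0 q (v ∸ 2) ⦄ (cong (q ^_) (m+[n∸m]≡n 2≤v))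
  open Excess z l (subst (k ≤_) (sym v≡) (m≤m+n k w)) refl

-- A spread beyond the bound is cut down to the one size for which the counting is carried out.
restrict : ∀ {c ℓ q} (F : FiniteField c ℓ q) {n n′ k v} (n′≤n : n′ ≤ n)
  {S : Fin n → Fin k → Vector F v} →
  IsPartialSpread F S → IsPartialSpread F (λ i → S (inject≤ i n′≤n))
restrict F n′≤n (indep , trivial) =
  (λ i → indep (inject≤ i n′≤n)) ,
  (λ i j i≢j → trivial _ _ (i≢j ∘ Fin.inject≤-injective n′≤n n′≤n i j))

theorem9 : ∀ {c ℓ : Level} (q : ℕ) (F : FiniteField c ℓ q)
    (r t u z m k v l : ℕ) →
    1 ≤ r → 2 ≤ t →
    m * (q ∸ 1) ≡ q ^ r ∸ 1 →
    2 * z ≤ m →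
    k ≡ m + 1 ∸ z + u →
    r < k →
    v ≡ k * t + r →
    l * (q ^ k ∸ 1) ≡ q ^ (v ∸ k) ∸ q ^ r →
    ∀ (n : ℕ) (S : Fin n → Fin k → Fin v → FiniteField.Carrier F) →
    IsPartialSpread F S →
    n ≤ l * q ^ k + 1 + z * (q ∸ 1)
theorem9 zero F r t u z m k v l 1≤r 2≤t m≡ 2z≤m refl r<k refl l≡ n S spread
  with () ← proj₁ (FiniteField.enum-surjective F (FiniteField.0# F))
-- For q = 1 the elements 0 and 1 would have the same index.
theorem9 (suc zero) F r t u z m k v l 1≤r 2≤t m≡ 2z≤m refl r<k refl l≡ n S spread
  with FiniteField.enum-surjective F (FiniteField.0# F) | FiniteField.enum-surjective F (FiniteField.1# F)
... | zero , e₀≈0 | zero , e₀≈1 =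
  contradiction (FiniteField.trans F (FiniteField.sym F e₀≈0) e₀≈1) (FiniteField.0≉1 F)
theorem9 (suc (suc p)) F r (suc (suc t)) u z m k v l 1≤r (s≤s (s≤s _)) m≡ 2z≤m refl r<k refl l≡ n S spread =
  ≮⇒≥ λ large →
    -- The successor in `large` is moved onto z p, turning the bound plus one into l qᵏ + 1 + y.
    let n′≤n = subst (_≤ n) (sym (+-suc (l * suc (suc p) ^ k + 1) (z * suc p))) large
    in no-large-spread (suc p) F r t u z m l 1≤r m≡ 2z≤m l≡ (λ i → S (inject≤ i n′≤n)) (restrict F n′≤n {S} spread)
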